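{- Let $r$ be a positive integer and $H = K_{2,r}$. Then there is a function $f_H(k) = O(r^2\cdot k^2)$ such that for every graph $G$, if $k = \mathbf{pack}_H(G)$, then $k \le \mathbf{cover}_H(G) \le f_H(k)$.
   Context: All graphs are finite, undirected, without loops. $K_{2,r}$ is the complete bipartite graph with parts of sizes $2$ and $r$. For a graph $H$, $\mathcal{M}(H)$ denotes the set of all graphs that can be contracted to $H$ (i.e. $H$ is obtained from them by a sequence of edge contractions); members of $\mathcal{M}(H)$ are called models of $H$. For a graph $G$, $\mathbf{cover}_H(G)$ is the minimum number of vertices of $G$ meeting every subgraph of $G$ that belongs to $\mathcal{M}(H)$, and $\mathbf{pack}_H(G)$ is the maximum number of pairwise vertex-disjoint subgraphs of $G$ belonging to $\mathcal{M}(H)$. The constant hidden in the $O$-notation is independent of $r$ and $k$. -}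

module Defs where

open import Data.Nat using (ℕ; _≤_; _<ᵇ_)
open import Data.Bool using (Bool; true; false; _xor_)
open import Data.Fin using (Fin; toℕ)
open import Data.Fin.Subset using (Subset; _∈_; ∣_∣)
open import Data.Product using (Σ; ∃; _×_)
open import Data.Empty using (⊥)
open import Relation.Binary.PropositionalEquality using (_≡_; _≢_)

record Graph : Set where
  field
    n      : ℕ
    adj    : Fin n → Fin n → Bool
    sym    : ∀ x y → adj x y ≡ adj y x
    irrefl : ∀ x → adj x x ≡ false
open Graph public

Edge : (G : Graph) → Fin (n G) → Fin (n G) → Set
Edge G x y = adj G x y ≡ true

K2 : ℕ → Graph
K2 r = record
  { n      = 2 Data.Nat.+ r
  ; adj    = λ x y → (toℕ x <ᵇ 2) xor (toℕ y <ᵇ 2)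
  ; sym    = λ x y → xor-comm (toℕ x <ᵇ 2) (toℕ y <ᵇ 2)
  ; irrefl = λ x → xor-self (toℕ x <ᵇ 2)
  }
  where
  xor-comm : ∀ a b → (a xor b) ≡ (b xor a)
  xor-comm false false = Relation.Binary.PropositionalEquality.refl
  xor-comm false true  = Relation.Binary.PropositionalEquality.refl
  xor-comm true  false = Relation.Binary.PropositionalEquality.refl
  xor-comm true  true  = Relation.Binary.PropositionalEquality.refl
  xor-self : ∀ a → (a xor a) ≡ false
  xor-self false = Relation.Binary.PropositionalEquality.refl
  xor-self true  = Relation.Binary.PropositionalEquality.refl

record Subgraph (G : Graph) : Set where
  field
    vs     : Subset (n G)
    es     : Fin (n G) → Fin (n G) → Bool
    es-sym : ∀ x y → es x y ≡ es y x
    es-sub : ∀ x y → es x y ≡ true → Edge G x y × x ∈ vs × y ∈ vs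
open Subgraph public

data Walk {V : Set} (P : V → Set) (R : V → V → Set) : V → V → Set where
  here : ∀ {x} → P x → Walk P R x x
  step : ∀ {x y z} → P x → R x y → Walk P R y z → Walk P R x z

-- S can be contracted to H (S ∈ M(H)), expressed by branch sets:
-- φ maps V(S) onto V(H); each branch set φ⁻¹(h) ∩ V(S) is connected in S;
-- and for distinct branch sets there is an edge of S between them iff the
-- corresponding vertices are adjacent in H.
IsModel : (H G : Graph) → Subgraph G → Set
IsModel H G S =
  Σ (Fin (n G) → Fin (n H)) λ φ →
    (∀ h → ∃ λ x → x ∈ vs S × φ x ≡ h)
  × (∀ x y → x ∈ vs S → y ∈ vs S → φ x ≡ φ y →
       Walk (λ z → z ∈ vs S × φ z ≡ φ x) (λ a b → es S a b ≡ true) x y)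
  × (∀ x y → es S x y ≡ true → φ x ≢ φ y → Edge H (φ x) (φ y))
  × (∀ h h' → Edge H h h' →
       ∃ λ x → ∃ λ y → es S x y ≡ true × φ x ≡ h × φ y ≡ h')

Hits : (H G : Graph) → Subset (n G) → Set
Hits H G X = ∀ S → IsModel H G S → ∃ λ x → x ∈ vs S × x ∈ X

IsCoverNumber : (H G : Graph) → ℕ → Set
IsCoverNumber H G m =
  (∃ λ X → ∣ X ∣ ≡ m × Hits H G X) × (∀ X → Hits H G X → m ≤ ∣ X ∣)

IsPacking : (H G : Graph) (t : ℕ) → (Fin t → Subgraph G) → Set
IsPacking H G t F =
  (∀ i → IsModel H G (F i))
  × (∀ i j → i ≢ j → ∀ x → x ∈ vs (F i) → x ∈ vs (F j) → ⊥)

IsPackNumber : (H G : Graph) → ℕ → Set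
IsPackNumber H G k =
  (Σ (Fin k → Subgraph G) λ F → IsPacking H G k F)
  × (∀ t F → IsPacking H G t F → t ≤ k)

{-# OPTIONS --safe #-}
module Submission where

-- Everything happens under double negation, the final inequality being decidable.
--
-- Let h = ⌊k/2⌋ and suppose that k + 1 disjoint models do not exist. If deleting some O(r k²) vertices
-- leaves only components packing at most h models, recurse into them: since Σ qᵢ² ≤ h k whenever
-- Σ qᵢ ≤ k and all qᵢ ≤ h, the total stays O(r k²). Otherwise, after every such deletion, a unique component packs more
-- than h models. Explore this big component C from two families of P = O(k) connected pieces, each
-- with up to t = O(r k) leaves next to C: a vertex of C next to a piece can always become a new leaf,
-- and C shrinks. When all leaves are in place, either a separator of C between the leaves of the two
-- families is small, and by Menger the leaves of one family can be moved onto it, so that C shrinks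
-- again; or there are P t disjoint connections between the two families. By pigeonhole k + 1 disjoint
-- pairs of pieces are then joined by at least r connections each, and each pair is a model of K_{2,r}.

open import Defs
open import Data.Bool using (true; false)
import Data.Bool.Properties as Bool
open import Level using (Level)
open import Data.Nat using (ℕ; zero; suc; _≤_; _<_; _*_; _+_; _∸_; z≤n; s≤s; ⌊_/2⌋; ⌈_/2⌉)
import Data.Nat.Properties as ℕ
open import Data.Fin as Fin using (Fin; zero; suc; combine; remQuot; inject≤; splitAt)
import Data.Fin.Properties as F
open import Data.Fin.Subset as Subset using (Subset; ∣_∣)
import Data.Fin.Subset.Properties as Subset
import Data.Vec as Vec
import Data.Vec.Properties as Vec
open import Data.List using (List; []; _∷_; length; _++_; filter; lookup; allFin; cartesianProduct)
import Data.List.Properties as L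
open import Data.List.Membership.Propositional using (_∈_; _∉_; find; lose)
open import Data.List.Membership.Propositional.Properties
  using (∈-lookup; ∈-++⁺ˡ; ∈-++⁺ʳ; ∈-++⁻; ∈-filter⁺; ∈-filter⁻; ∈-allFin; ∈-cartesianProduct⁺)
open import Data.List.Relation.Unary.Any as Any using (here; there; index)
open import Data.List.Relation.Unary.Any.Properties using (lookup-index)
open import Data.List.Relation.Unary.All as All using ([]; _∷_)
open import Data.List.Relation.Unary.AllPairs using ([]; _∷_)
open import Data.List.Relation.Unary.Unique.Propositional using (Unique)
import Data.List.Relation.Unary.Unique.Propositional.Properties as Unique
open import Data.Product using (Σ; ∃; ∃₂; _×_; _,_; proj₁; proj₂)
open import Data.Sum using (_⊎_; inj₁; inj₂; [_,_]′)
open import Data.Maybe using (Maybe; just; nothing)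
open import Data.Empty using (⊥)
open import Data.Unit using (⊤)
open import Function using (_∘_; id; mk⇔)
open import Relation.Nullary using (¬_; Dec; yes; no; does; contradiction)
open import Relation.Nullary.Decidable
  using (¬¬-excluded-middle; decidable-stable; ¬?; _×-dec_; _⊎-dec_; dec-true; does-⇔)
open import Relation.Binary.Definitions using (DecidableEquality)
open import Relation.Binary.PropositionalEquality
  using (_≡_; _≢_; refl; trans; cong; subst; subst₂)
  renaming (sym to ≡-sym)

-- Reachability, components and the existence of small cuts are undecided predicates here, so case
-- distinctions on them go through `em`; hence the double negation.
--
-- The obstacle is that the exploration may run through the whole graph, while the hypothesis on
-- deletions speaks of boundedly many vertices only. So pieces may grow without limit, but just
-- those labelled vertices that still touch C are counted: at most one core vertex and t leaves per
-- piece, 2 P (t + 1) in all. Deleting these together with a cut of at most P t vertices leaves a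
-- big component. Two disjoint big sets would pack 2 (h + 1) > k models, so that component meets C,
-- and it cannot leave C because the exits have been deleted. In this way C survives each step as a
-- smaller big set.
--
-- As there are two families, what is left of C behind a cut can touch leaves outside the cut in one
-- family at most, else it would connect the two families around the cut. The other family is the
-- one whose leaves are moved, and the vertices that its new leaves are reached through have lost
-- contact with C.

private variable
  a : Level
  A B : Set a
  m k : ℕ

-- Double negation and finite counting

infixl 1 _>>=_

_>>=_ : ¬ ¬ A → (A → ¬ ¬ B) → ¬ ¬ B
(m >>= f) ¬b = m λ x → f x ¬b

return : A → ¬ ¬ A
return x ¬x = ¬x x

em : (A : Set a) → ¬ ¬ Dec A
em _ = ¬¬-excluded-middle

¬¬-Fin : {P : Fin m → Set a} → (∀ i → ¬ ¬ P i) → ¬ ¬ (∀ i → P i)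
¬¬-Fin {m = zero}  h = return λ ()
¬¬-Fin {m = suc m} h = do
  p ← h zero
  q ← ¬¬-Fin (h ∘ suc)
  return λ { zero → p ; (suc i) → q i }

length≥-injection : {xs : List A} (f : Fin k → A) →
  (∀ {i j} → f i ≡ f j → i ≡ j) → (∀ i → f i ∈ xs) → k ≤ length xs
length≥-injection {xs = xs} f inj mem = F.injective⇒≤ {f = index ∘ mem} λ {i} {j} e →
  inj (trans (lookup-index (mem i)) (trans (cong (lookup xs) e) (≡-sym (lookup-index (mem j)))))

injective⇒surjective : (f : Fin k → Fin k) → (∀ {i j} → f i ≡ f j → i ≡ j) →
  ∀ y → ∃ λ x → f x ≡ y
injective⇒surjective {k} f inj y with F.any? (λ x → f x F.≟ y)
... | yes p = p
... | no ¬p = contradiction (length≥-injection f inj mem) 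
    (ℕ.<⇒≱ (subst (length rest <_) (L.length-tabulate id) shorter))
  where
  rest = filter (λ z → ¬? (z F.≟ y)) (allFin k)
  shorter : length rest < length (allFin k)
  shorter = L.filter-notAll _ (allFin k) (Any.map (λ { refl q → q refl }) (∈-allFin y))
  mem : ∀ i → f i ∈ rest
  mem i = ∈-filter⁺ _ (∈-allFin (f i)) λ e → ¬p (i , e)

lookup-injective : {xs : List A} → Unique xs → ∀ i j → lookup xs i ≡ lookup xs j → i ≡ j
lookup-injective (_ ∷ _)  zero    zero    _ = refl
lookup-injective (x∉ ∷ _) zero    (suc j) e = contradiction e (All.lookup x∉ (∈-lookup j))
lookup-injective (x∉ ∷ _) (suc i) zero    e = contradiction (≡-sym e) (All.lookup x∉ (∈-lookup i))
lookup-injective (_ ∷ u)  (suc i) (suc j) e = cong suc (lookup-injective u i j e)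

-- Walks

private variable
  V : Set
  P Q : V → Set
  R S : V → V → Set
  x y z : V

Walk-map : (∀ {x} → P x → Q x) → (∀ {x y} → R x y → S x y) → Walk P R x y → Walk Q S x y
Walk-map f g (here p)     = here (f p)
Walk-map f g (step p r w) = step (f p) (g r) (Walk-map f g w)

Walk-start : Walk P R x y → P x
Walk-start (here p)     = p
Walk-start (step p _ _) = p

Walk-end : Walk P R x y → P y
Walk-end (here p)     = p
Walk-end (step _ _ w) = Walk-end w

_++ʷ_ : Walk P R x y → Walk P R y z → Walk P R x z
here _     ++ʷ v = v
step p r w ++ʷ v = step p r (w ++ʷ v)

Walk-snoc : Walk P R x y → R y z → P z → Walk P R x z
Walk-snoc w r p = w ++ʷ step (Walk-end w) r (here p)

Walk-reverse : (∀ {x y} → R x y → R y x) → Walk P R x y → Walk P R y x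
Walk-reverse s (here p)     = here p
Walk-reverse s (step p r w) = Walk-snoc (Walk-reverse s w) (s r) p

Walk-invariant : (∀ {x y} → Q x → P x → R x y → P y → Q y) →
  Q x → Walk P R x y → Walk (λ z → P z × Q z) R x y
Walk-invariant c q (here p)     = here (p , q)
Walk-invariant c q (step p r w) = step (p , q) r (Walk-invariant c (c q p r (Walk-start w)) w)

-- Turns a walk into one inside the component of its start; this is how components are shown to be
-- connected within themselves.
Walk-reachable : Walk P R x y → Walk (Walk P R x) R x y
Walk-reachable w = Walk-map proj₂ id (Walk-invariant (λ v _ → Walk-snoc v) (here (Walk-start w)) w)

-- Cuts the walk just ahead of its first visit to `z`. In `push` the part kept joins the core of a
-- piece, and `z` becomes a leaf.
Walk-before : DecidableEquality V → {P : V → Set} {R : V → V → Set} {x z : V} → Walk P R x z →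
  x ≡ z ⊎ ∃ λ w → Walk (λ v → P v × v ≢ z) R x w × R w z
Walk-before _≟_ (here p) = inj₁ refl
Walk-before _≟_ {x = x} {z} (step p r w) with x ≟ z | Walk-before _≟_ w
... | yes e | _ = inj₁ e
... | no ne | inj₁ refl = inj₂ (_ , here (p , ne) , r)
... | no ne | inj₂ (u , v , s) = inj₂ (u , step (p , ne) r v , s)

Walk-from : x ≡ y → Walk P R y z → Walk P R x z
Walk-from refl w = w

-- Linkages and Menger's theorem

Adj : List (V × V) → V → V → Set
Adj es x y = (x , y) ∈ es ⊎ (y , x) ∈ es

Adj-sym : {es : List (V × V)} → Adj es x y → Adj es y x
Adj-sym = [ inj₂ , inj₁ ]′

Avoid : (V → Set) → List V → V → Set
Avoid W Z x = W x × x ∉ Z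

Separates : List (V × V) → (W A B : V → Set) → List V → Set
Separates es W A B Z = ∀ {a b} → A a → B b → ¬ Walk (Avoid W Z) (Adj es) a b

-- The members are disjoint vertex sets rather than paths: this suffices for gluing and for branch sets.
record Linkage (es : List (V × V)) (W A B : V → Set) (k : ℕ) : Set₁ where
  field
    M        : Fin k → V → Set
    M⊆W      : ∀ {i x} → M i x → W x
    disjoint : ∀ {i j x} → M i x → M j x → i ≡ j
    src tgt  : Fin k → V
    src∈     : ∀ i → A (src i)
    tgt∈     : ∀ i → B (tgt i)
    walk     : ∀ i → Walk (M i) (Adj es) (src i) (tgt i)

  src-injective : ∀ {i j} → src i ≡ src j → i ≡ j
  src-injective {i} {j} e = disjoint (Walk-start (walk i)) (subst (M j) (≡-sym e) (Walk-start (walk j)))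

  tgt-injective : ∀ {i j} → tgt i ≡ tgt j → i ≡ j
  tgt-injective {i} {j} e = disjoint (Walk-end (walk i)) (subst (M j) (≡-sym e) (Walk-end (walk j)))

  M-src : ∀ i → M i (src i)
  M-src i = Walk-start (walk i)

  M-tgt : ∀ i → M i (tgt i)
  M-tgt i = Walk-end (walk i)

record Bijective (f : Fin k → V) (Z : List V) : Set where
  field
    pos     : Fin k → Fin (length Z)
    inv     : Fin (length Z) → Fin k
    pos-inv : ∀ p → pos (inv p) ≡ p
    f-inv   : ∀ p → f (inv p) ≡ lookup Z p

  inv-injective : ∀ {p q} → inv p ≡ inv q → p ≡ q
  inv-injective {p} {q} e = trans (≡-sym (pos-inv p)) (trans (cong pos e) (pos-inv q))

  preimage : ∀ {x} → x ∈ Z → ∃ λ i → f i ≡ x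
  preimage x∈ = inv (index x∈) , trans (f-inv _) (≡-sym (lookup-index x∈))

bijective : (f : Fin k → V) (Z : List V) → (∀ {i j} → f i ≡ f j → i ≡ j) →
  (∀ i → f i ∈ Z) → length Z ≡ k → Bijective f Z
bijective f Z inj mem refl = record
  { pos     = pos
  ; inv     = proj₁ ∘ onto
  ; pos-inv = proj₂ ∘ onto
  ; f-inv   = λ p → trans (lookup-index (mem _)) (cong (lookup Z) (proj₂ (onto p)))
  }
  where
  pos = index ∘ mem
  onto = injective⇒surjective pos λ {i} {j} e →
    inj (trans (lookup-index (mem i)) (trans (cong (lookup Z) e) (≡-sym (lookup-index (mem j)))))

Reached : List (V × V) → (W A : V → Set) → List V → V → Set
Reached es W A S x = ∃ λ a → A a × Walk (Avoid W S) (Adj es) a x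

comprehension : (P : Fin m → Set) →
  ¬ ¬ (∃ λ Z → Unique Z × (∀ x → x ∈ Z → P x) × (∀ x → P x → x ∈ Z))
comprehension {m} P = do
  P? ← ¬¬-Fin (λ i → em (P i))
  return (filter P? (allFin m) , Unique.filter⁺ P? (Unique.allFin⁺ m)
         , (λ x x∈ → proj₂ (∈-filter⁻ P? {xs = allFin m} x∈)) , λ x → ∈-filter⁺ P? (∈-allFin x))

module Menger {m : ℕ} where

  private
    V₀ = Fin m
  open import Data.List.Membership.DecPropositional (F._≟_ {m}) using (_∈?_)

  -- By `¬B` a walk from `A` to `B` has to leave the reached side; `exit` and `S⊆T` make it meet `T`
  -- on the way out, and its part up to there runs in `Near`, where `Z` blocks it. The second edge
  -- set `es'` serves the induction on edges in `menger`.
  confine : {es es' : List (V₀ × V₀)} {W A B : V₀ → Set} {S T Z : List V₀} →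
    (∀ {x} → x ∈ S → x ∈ T) →
    (∀ {x y} → Reached es W A S x → Adj es' x y → W y → Adj es x y ⊎ x ∈ T) →
    (∀ {x} → Reached es W A S x → ¬ B x) →
    Separates es (λ x → W x × (Reached es W A S x ⊎ x ∈ S)) A (_∈ T) Z →
    Separates es' W A B Z
  confine {es} {es'} {W} {A} {B} {S} {T} {Z} S⊆T exit ¬B sep {a} {b} Aa Bb w = start (a ∈? S)
    where
    Near = λ x → W x × (Reached es W A S x ⊎ x ∈ S)

    go : ∀ {x} → Walk (Avoid Near Z) (Adj es) a x → Reached es W A S x →
         Walk (Avoid W Z) (Adj es') x b → ⊥
    go u r (here _) = ¬B r Bb
    go {x} u r@(c , Ac , v) (step {y = y} p e w) with Walk-start w
    ... | Wy , y∉Z with exit r e Wy | y ∈? S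
    ... | inj₂ x∈T | _       = sep Aa x∈T u
    ... | inj₁ e'  | yes y∈S = sep Aa (S⊆T y∈S) (Walk-snoc u e' ((Wy , inj₂ y∈S) , y∉Z))
    ... | inj₁ e'  | no  y∉S = go (Walk-snoc u e' ((Wy , inj₁ r') , y∉Z)) r' w
      where r' = c , Ac , Walk-snoc v e' (Wy , y∉S)

    start : Dec (a ∈ S) → ⊥
    start (yes a∈S) with Walk-start w
    ... | Wa , a∉Z = sep Aa (S⊆T a∈S) (here ((Wa , inj₂ a∈S) , a∉Z))
    start (no a∉S) with Walk-start w
    ... | Wa , a∉Z = go (here ((Wa , inj₁ r) , a∉Z)) r w
      where r = a , Aa , here (Wa , a∉S)

  -- Linkages meeting only in S, on either side of the edge x₀y₀ : the members ending in s ∈ S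
  -- are joined there, and those ending in x₀ and y₀ along the edge.
  join : {es es' : List (V₀ × V₀)} {W W₁ W₂ A B : V₀ → Set} {S : List V₀} {x₀ y₀ : V₀} →
    (∀ {x y} → Adj es x y → Adj es' x y) → Adj es' x₀ y₀ →
    (∀ {x} → W₁ x → W x) → (∀ {x} → W₂ x → W x) → (∀ {x} → W₁ x → W₂ x → x ∈ S) →
    Linkage es W₁ A (_∈ x₀ ∷ S) (suc (length S)) →
    Linkage es W₂ (_∈ y₀ ∷ S) B (suc (length S)) →
    Linkage es' W A B (suc (length S))
  join {es} {S = S} {x₀} {y₀} weaken e₀ W₁⊆ W₂⊆ ∩⊆S L₁ L₂ = record
    { M        = λ p x → L₁.M (β₁.inv p) x ⊎ L₂.M (β₂.inv p) x
    ; M⊆W      = [ W₁⊆ ∘ L₁.M⊆W , W₂⊆ ∘ L₂.M⊆W ]′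
    ; disjoint = λ
        { (inj₁ u) (inj₁ v) → β₁.inv-injective (L₁.disjoint u v)
        ; (inj₁ u) (inj₂ v) → cross u v
        ; (inj₂ u) (inj₁ v) → ≡-sym (cross v u)
        ; (inj₂ u) (inj₂ v) → β₂.inv-injective (L₂.disjoint u v) }
    ; src      = λ p → L₁.src (β₁.inv p)
    ; tgt      = λ p → L₂.tgt (β₂.inv p)
    ; src∈     = λ p → L₁.src∈ (β₁.inv p)
    ; tgt∈     = λ p → L₂.tgt∈ (β₂.inv p)
    ; walk     = joined
    }
    where
    module L₁ = Linkage L₁
    module L₂ = Linkage L₂
    -- Each linkage has as many members as its end set `x₀ ∷ S` or `y₀ ∷ S` has entries, so members
    -- can be indexed by the position of their end; position `zero` is the one that crosses the
    -- edge.
    module β₁ = Bijective (bijective L₁.tgt (x₀ ∷ S) L₁.tgt-injective L₁.tgt∈ refl)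
    module β₂ = Bijective (bijective L₂.src (y₀ ∷ S) L₂.src-injective L₂.src∈ refl)

    -- A shared vertex lies in `S`, and on either side the member through it is the one whose end it
    -- is, so both have its position.
    cross : ∀ {p q x} → L₁.M (β₁.inv p) x → L₂.M (β₂.inv q) x → p ≡ q
    cross {p} {q} {x} u v = trans
      (β₁.inv-injective (L₁.disjoint u (subst (L₁.M _) (trans (β₁.f-inv (suc (index x∈S))) (≡-sym x≡)) (L₁.M-tgt _))))
      (≡-sym (β₂.inv-injective (L₂.disjoint v (subst (L₂.M _) (trans (β₂.f-inv (suc (index x∈S))) (≡-sym x≡)) (L₂.M-src _)))))
      where
      x∈S = ∩⊆S (L₁.M⊆W u) (L₂.M⊆W v)
      x≡ : x ≡ lookup S (index x∈S)
      x≡ = lookup-index x∈S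

    left : ∀ p → Walk (λ x → L₁.M (β₁.inv p) x ⊎ L₂.M (β₂.inv p) x) (Adj _)
                   (L₁.src (β₁.inv p)) (lookup (x₀ ∷ S) p)
    left p = Walk-map inj₁ weaken (subst (Walk _ _ _) (β₁.f-inv p) (L₁.walk (β₁.inv p)))

    right : ∀ p → Walk (λ x → L₁.M (β₁.inv p) x ⊎ L₂.M (β₂.inv p) x) (Adj _)
                    (lookup (y₀ ∷ S) p) (L₂.tgt (β₂.inv p))
    right p = Walk-map inj₂ weaken (Walk-from (≡-sym (β₂.f-inv p)) (L₂.walk (β₂.inv p)))

    joined : ∀ p → Walk _ (Adj _) (L₁.src (β₁.inv p)) (L₂.tgt (β₂.inv p))
    joined zero    = Walk-snoc (left zero) e₀ (Walk-start (right zero)) ++ʷ right zero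
    joined (suc q) = left (suc q) ++ʷ right (suc q)

  private
    Along : V₀ × V₀ → V₀ → V₀ → Set
    Along e x y = e ≡ (x , y) ⊎ e ≡ (y , x)

    Adj-∷ : ∀ {e es x y} → Adj (e ∷ es) x y → Adj es x y ⊎ Along e x y
    Adj-∷ (inj₁ (here refl)) = inj₂ (inj₁ refl)
    Adj-∷ (inj₁ (there p))   = inj₁ (inj₁ p)
    Adj-∷ (inj₂ (here refl)) = inj₂ (inj₂ refl)
    Adj-∷ (inj₂ (there p))   = inj₁ (inj₂ p)

    Along⇒Adj : ∀ {e es x y} → Along e x y → Adj (e ∷ es) x y
    Along⇒Adj (inj₁ refl) = inj₁ (here refl)
    Along⇒Adj (inj₂ refl) = inj₂ (here refl)

    Along-unique : ∀ {e x y u v} → Along e x y → Along e u v → (u ≡ x × v ≡ y) ⊎ (u ≡ y × v ≡ x)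
    Along-unique (inj₁ refl) (inj₁ refl) = inj₁ (refl , refl)
    Along-unique (inj₁ refl) (inj₂ refl) = inj₂ (refl , refl)
    Along-unique (inj₂ refl) (inj₁ refl) = inj₂ (refl , refl)
    Along-unique (inj₂ refl) (inj₂ refl) = inj₁ (refl , refl)

  -- Göring's proof: if deleting an edge leaves a separator S smaller than k, then the edge x₀y₀
  -- crosses S, and both S + x₀ and S + y₀ separate with exactly k vertices.
  menger : (es : List (V₀ × V₀)) (W A B : V₀ → Set) (k : ℕ) →
    (∀ Z → Separates es W A B Z → k ≤ length Z) → ¬ ¬ Linkage es W A B k
  menger [] W A B k big = do
    -- Without edges every walk is a single vertex, so the common vertices of `W`, `A` and `B` form
    -- a separator; `k` of them serve as members.
    Z , uniq , sound , complete ← comprehension (λ x → W x × A x × B x)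
    let k≤ = big Z λ { Aa Bb (here (Wa , a∉Z)) → a∉Z (complete _ (Wa , Aa , Bb))
                     ; _ _ (step _ (inj₁ ()) _) ; _ _ (step _ (inj₂ ()) _) }
        z  = λ i → lookup Z (inject≤ i k≤)
        z∈ = λ i → sound _ (∈-lookup {xs = Z} (inject≤ i k≤))
    return record
      { M        = λ i x → x ≡ z i
      ; M⊆W      = λ { {i} refl → proj₁ (z∈ i) }
      ; disjoint = λ { {i} {j} refl e → F.inject≤-injective k≤ k≤ i j (lookup-injective uniq _ _ e) }
      ; src      = z
      ; tgt      = z
      ; src∈     = proj₁ ∘ proj₂ ∘ z∈
      ; tgt∈     = proj₂ ∘ proj₂ ∘ z∈
      ; walk     = λ i → here refl
      }
  menger (e ∷ es) W A B k big = do
    yes (S , S<k , sepS) ← em (∃ λ S → length S < k × Separates es W A B S)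
      where
      no none → do
        L ← menger es W A B k λ Z sep → ℕ.≮⇒≥ λ Z<k → none (Z , Z<k , sep)
        let open Linkage L
        return record
          { M = M ; M⊆W = M⊆W ; disjoint = disjoint ; src = src ; tgt = tgt
          ; src∈ = src∈ ; tgt∈ = tgt∈
          ; walk = λ i → Walk-map id [ inj₁ ∘ there , inj₂ ∘ there ]′ (walk i) }
    let Rch = Reached es W A S
        ¬B : ∀ {x} → Rch x → ¬ B x
        ¬B = λ { (a , Aa , w) Bx → sepS Aa Bx w }
    x₀ , y₀ , rx₀ , ¬ry₀ , along ← crossing S S<k sepS
    let exit : ∀ {x y} → Rch x → Adj (e ∷ es) x y → Adj es x y ⊎ (x ≡ x₀ × y ≡ y₀)
        exit = λ rx r → [ inj₁ , (λ al → [ inj₂ , (λ { (refl , refl) → contradiction rx ¬ry₀ }) ]′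
                                           (Along-unique along al)) ]′ (Adj-∷ r)
    L₁ ← menger es (λ x → W x × (Rch x ⊎ x ∈ S)) A (_∈ x₀ ∷ S) k λ Z sep →
           big Z (confine there (λ rx r _ → [ inj₁ , (λ { (refl , _) → inj₂ (here refl) }) ]′ (exit rx r)) ¬B sep)
    L₂ ← menger es (λ x → W x × ¬ Rch x) (_∈ y₀ ∷ S) B k λ Z sep →
           big Z (confine-far S exit (inner rx₀ along) ¬B sep)
    -- The `k` ends of `L₁` are distinct entries of `x₀ ∷ S`, and `S` is shorter than `k`; so the
    -- counts agree, as `join` requires.
    let k≡ = ℕ.≤-antisym S<k (length≥-injection (Linkage.tgt L₁) (Linkage.tgt-injective L₁) (Linkage.tgt∈ L₁))
    return (finish S k≡ along L₁ L₂)
    where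
    -- If `e` never led out of the reached side, `S` would still separate with `e` present, against
    -- `big`.
    crossing : ∀ S → length S < k → Separates es W A B S →
      ¬ ¬ (∃₂ λ x y → Reached es W A S x × ¬ Reached es W A S y × Along e x y)
    crossing S S<k sepS none = ℕ.<⇒≱ S<k (big S λ Aa Bb w →
      go Bb (_ , Aa , here (Walk-start w)) w)
      where
      go : ∀ {x b} → B b → Reached es W A S x → Walk (Avoid W S) (Adj (e ∷ es)) x b → ⊥
      go Bb (a , Aa , v) (here _) = sepS Aa Bb v
      go Bb (a , Aa , v) (step p r w) with Adj-∷ r
      ... | inj₁ r' = go Bb (a , Aa , Walk-snoc v r' (Walk-start w)) w
      ... | inj₂ al = none (_ , _ , (a , Aa , v) , (λ ry → go Bb ry w) , al)

    inner : ∀ {S x₀ y₀ x y} → Reached es W A S x₀ → Along e x₀ y₀ →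
      ¬ Reached es W A S x → ¬ Reached es W A S y → Adj (e ∷ es) x y → Adj es x y
    inner rx₀ along ¬rx ¬ry r with Adj-∷ r
    ... | inj₁ r' = r'
    ... | inj₂ al with Along-unique along al
    ... | inj₁ (refl , _) = contradiction rx₀ ¬rx
    ... | inj₂ (_ , refl) = contradiction rx₀ ¬ry

    -- The counterpart of `confine` beyond `S`. Since reachability is measured from `A`, the walk is
    -- read from its end in `B`: if a step came from the reached side, the suffix after it would
    -- begin at `y₀` or in `S` and miss `Z`, against `sep`. So the whole walk stays far, although
    -- its start in `A` is reached or in `S`.
    confine-far : ∀ S {x₀ y₀ Z} →
      (∀ {x y} → Reached es W A S x → Adj (e ∷ es) x y → Adj es x y ⊎ (x ≡ x₀ × y ≡ y₀)) →
      (∀ {x y} → ¬ Reached es W A S x → ¬ Reached es W A S y → Adj (e ∷ es) x y → Adj es x y) →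
      (∀ {x} → Reached es W A S x → ¬ B x) →
      Separates es (λ x → W x × ¬ Reached es W A S x) (_∈ y₀ ∷ S) B Z →
      Separates (e ∷ es) W A B Z
    confine-far S {x₀} {y₀} {Z} exit inner ¬B sep {a} {b} Aa Bb w =
      start (Walk-start v) (a ∈? S)
      where
      Far = λ x → W x × ¬ Reached es W A S x

      back : ∀ {x} → Walk (Avoid W Z) (Adj (e ∷ es)) x b → Walk (Avoid Far Z) (Adj es) x b
      back (here (Wb , b∉Z)) = here ((Wb , λ rb → ¬B rb Bb) , b∉Z)
      back (step {x} {y} (Wx , x∉Z) r w) with back w
      ... | v with Walk-start v
      ... | (Wy , ¬ry) , y∉Z = step ((Wx , ¬rx) , x∉Z) (inner ¬rx ¬ry r) v
        where
        ¬rx : ¬ Reached es W A S x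
        ¬rx rx@(c , Ac , u) with exit rx r | y ∈? S
        ... | inj₂ (_ , refl) | _ = sep (here refl) Bb v
        ... | inj₁ r' | yes y∈S = sep (there y∈S) Bb v
        ... | inj₁ r' | no y∉S  = ¬ry (c , Ac , Walk-snoc u r' (Wy , y∉S))

      v = back w

      start : Avoid Far Z a → Dec (a ∈ S) → ⊥
      start _                (yes a∈S) = sep (there a∈S) Bb v
      start ((Wa , ¬ra) , _) (no a∉S)  = ¬ra (a , Aa , here (Wa , a∉S))

    finish : ∀ S {x₀ y₀} → suc (length S) ≡ k → Along e x₀ y₀ →
      Linkage es (λ x → W x × (Reached es W A S x ⊎ x ∈ S)) A (_∈ x₀ ∷ S) k →
      Linkage es (λ x → W x × ¬ Reached es W A S x) (_∈ y₀ ∷ S) B k →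
      Linkage (e ∷ es) W A B k
    finish S refl along = join [ inj₁ ∘ there , inj₂ ∘ there ]′ (Along⇒Adj along) proj₁ proj₁
      λ { (_ , inj₁ rx) (_ , ¬rx) → contradiction rx ¬rx ; (_ , inj₂ x∈S) _ → x∈S }

  Separates-sym : {es : List (V₀ × V₀)} {W A B : V₀ → Set} {Z : List V₀} →
    Separates es W A B Z → Separates es W B A Z
  Separates-sym sep Bb Aa w = sep Aa Bb (Walk-reverse Adj-sym w)

  Smallest : (List V₀ → Set) → List V₀ → Set
  Smallest Sep Z = Sep Z × (∀ Z' → Sep Z' → length Z ≤ length Z')

  smallest : (Sep : List V₀ → Set) → ∀ l Z → length Z ≤ l → Sep Z →
    ¬ ¬ (∃ λ Z → length Z ≤ l × Smallest Sep Z)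
  smallest Sep l Z Z≤l sep = do
    yes (Z' , Z'<Z , sep') ← em (∃ λ Z' → length Z' < length Z × Sep Z')
      where no none → return (Z , Z≤l , sep , λ Z' sep' → ℕ.≮⇒≥ λ Z'<Z → none (Z' , Z'<Z , sep'))
    descend l (ℕ.<-≤-trans Z'<Z Z≤l) sep'
    where
    descend : ∀ l {Z'} → length Z' < l → Sep Z' → ¬ ¬ (∃ λ Z → length Z ≤ l × Smallest Sep Z)
    descend (suc l) {Z'} (s≤s Z'≤l) sep' = do
      Z , Z≤l , small ← smallest Sep l Z' Z'≤l sep'
      return (Z , ℕ.m≤n⇒m≤1+n Z≤l , small)

  large-or-smallest : (Sep : List V₀ → Set) → ∀ N →
    ¬ ¬ ((∀ Z → Sep Z → N ≤ length Z) ⊎ ∃ λ Z → length Z < N × Smallest Sep Z)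
  large-or-smallest Sep N = do
    yes (Z , Z<N , sep) ← em (∃ λ Z → length Z < N × Sep Z)
      where no none → return (inj₁ λ Z sep → ℕ.≮⇒≥ λ Z<N → none (Z , Z<N , sep))
    Z' , Z'≤Z , small ← smallest Sep (length Z) Z ℕ.≤-refl sep
    return (inj₂ (Z' , ℕ.≤-<-trans Z'≤Z Z<N , small))

  linkage-or-cut : ∀ es W A B N →
    ¬ ¬ (Linkage es W A B N ⊎ ∃ λ Z → length Z < N × Smallest (Separates es W A B) Z)
  linkage-or-cut es W A B N = do
    inj₁ large ← large-or-smallest (Separates es W A B) N
      where inj₂ small → return (inj₂ small)
    L ← menger es W A B N large
    return (inj₁ L)

  -- A set separating `A` from `Z` on the near side also separates `A` from `B`, by `confine` with
  -- no edge added; so it is at least as large as the smallest cut `Z`.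
  link-to-cut : ∀ es W A B Z → Smallest (Separates es W A B) Z →
    ¬ ¬ Linkage es (λ x → W x × (Reached es W A Z x ⊎ x ∈ Z)) A (_∈ Z) (length Z)
  link-to-cut es W A B Z (sep , small) = menger es _ A (_∈ Z) (length Z) λ Z' sep' →
    small Z' (confine id (λ _ r _ → inj₁ r) (λ { (a , Aa , w) Bx → sep Aa Bx w }) sep')

-- Matching pieces by pigeonhole

Unique⇒length≤ : {A : Set} {xs : List A} {N : ℕ} → Unique xs → (f : A → Fin N) →
  (∀ {x y} → x ∈ xs → y ∈ xs → f x ≡ f y → x ≡ y) → length xs ≤ N
Unique⇒length≤ {xs = xs} u f inj = F.injective⇒≤ {f = f ∘ lookup xs} λ {i} {j} e →
  lookup-injective u i j (inj (∈-lookup i) (∈-lookup j) e)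

length-filter-split : {A : Set} {P : A → Set} (P? : ∀ x → Dec (P x)) (xs : List A) →
  length xs ≡ length (filter P? xs) + length (filter (¬? ∘ P?) xs)
length-filter-split P? [] = refl
length-filter-split P? (x ∷ xs) with P? x
... | yes _ = cong suc (length-filter-split P? xs)
... | no _  = trans (cong suc (length-filter-split P? xs)) (≡-sym (ℕ.+-suc _ _))

pigeonhole : {A B : Set} (_≟_ : DecidableEquality B) (f : A → B) (r : ℕ) (cs : List B) (xs : List A) →
  Unique xs → (∀ {x} → x ∈ xs → f x ∈ cs) →
  (∀ {ys c} → Unique ys → (∀ {y} → y ∈ ys → y ∈ xs × f y ≡ c) → length ys ≤ r) →
  length xs ≤ length cs * r
pigeonhole _≟_ f r [] [] u col light = z≤n
pigeonhole _≟_ f r [] (x ∷ xs) u col light = contradiction (col (here refl)) λ ()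
pigeonhole _≟_ f r (c ∷ cs) xs u col light = subst (_≤ _) (≡-sym (length-filter-split c? xs))
  (ℕ.+-mono-≤ (light (Unique.filter⁺ c? u) (∈-filter⁻ c? {xs = xs}))
    (pigeonhole _≟_ f r cs rest (Unique.filter⁺ (¬? ∘ c?) u) col'
      λ u' sub → light u' λ y∈ → let y∈rest , e = sub y∈ in proj₁ (∈-filter⁻ (¬? ∘ c?) {xs = xs} y∈rest) , e))
  where
  c?   = λ x → f x ≟ c
  rest = filter (¬? ∘ c?) xs
  col' : ∀ {x} → x ∈ rest → f x ∈ cs
  col' x∈ with x∈xs , ne ← ∈-filter⁻ (¬? ∘ c?) {xs = xs} x∈ with col x∈xs
  ... | here e  = contradiction e ne
  ... | there p = p

-- The items will be the linkage members, `p` and `p'` the pieces at their two ends; a piece has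
-- only `t` slots for leaves, whence `thin` and `thin'`.
module Matching {I : Set} {P t r : ℕ} (p p' : I → Fin P)
  (thin  : ∀ {ys j} → Unique ys → (∀ {y} → y ∈ ys → p y ≡ j) → length ys ≤ t)
  (thin' : ∀ {ys j} → Unique ys → (∀ {y} → y ∈ ys → p' y ≡ j) → length ys ≤ t)
  (1≤t : 1 ≤ t) (1≤r : 1 ≤ r)
  where

  record HeavyMatching (q : ℕ) (xs : List I) : Set where
    field
      J J'    : Fin q → Fin P
      J-inj   : ∀ {m m'} → J m ≡ J m' → m ≡ m'
      J'-inj  : ∀ {m m'} → J' m ≡ J' m' → m ≡ m'
      item    : Fin q → Fin r → I
      item∈   : ∀ m l → item m l ∈ xs
      item-inj : ∀ m {l l'} → item m l ≡ item m l' → l ≡ l'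
      item-J  : ∀ m l → p (item m l) ≡ J m
      item-J' : ∀ m l → p' (item m l) ≡ J' m

  -- Every pair of pieces with fewer than r items is negligible in total; a heavy pair is removed
  -- together with the at most 2t items of its two pieces.
  matching : ∀ q xs → Unique xs → q * (t + t) + P * P * r ≤ length xs → ¬ ¬ HeavyMatching q xs
  matching zero xs _ _ = return record
    { J = λ () ; J' = λ () ; J-inj = λ { {()} } ; J'-inj = λ { {()} } ; item = λ () ; item∈ = λ ()
    ; item-inj = λ () ; item-J = λ () ; item-J' = λ () }
  matching (suc q) xs u large = do
    yes (ys , (j , j') , uys , sub , r≤) ← em (∃₂ λ ys c → Unique ys ×
         (∀ y → y ∈ ys → y ∈ xs × (p y , p' y) ≡ c) × r ≤ length ys)
      where
      no light → contradiction
        (pigeonhole F._≟_ (λ x → combine (p x) (p' x)) r (allFin (P * P)) xs u (λ _ → ∈-allFin _)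
          λ {ys} {c} uys sub → ℕ.≰⇒≥ λ r≤ → light (ys , remQuot P c , uys ,
            (λ y y∈ → let y∈xs , e = sub y∈ in
              y∈xs , trans (≡-sym (F.remQuot-combine (p y) (p' y))) (cong (remQuot P) e)) , r≤))
        (ℕ.<⇒≱ (subst (λ l → l * r < length xs) (≡-sym (L.length-tabulate {n = P * P} id)) strict))
    let p?  = λ x → p x F.≟ j
        p'? = λ x → p' x F.≟ j'
        xs₁ = filter (¬? ∘ p?) xs
        xs₂ = filter (¬? ∘ p'?) xs₁
        u₁  = Unique.filter⁺ (¬? ∘ p?) u
        bound = ℕ.≤-trans (ℕ.≤-reflexive (length-filter-split p? xs))
          (ℕ.+-mono-≤ (thin (Unique.filter⁺ p? u) (λ y∈ → proj₂ (∈-filter⁻ p? {xs = xs} y∈)))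
            (ℕ.≤-trans (ℕ.≤-reflexive (length-filter-split p'? xs₁))
              (ℕ.+-monoˡ-≤ (length xs₂) (thin' (Unique.filter⁺ p'? u₁) (λ y∈ → proj₂ (∈-filter⁻ p'? {xs = xs₁} y∈))))))
    H ← matching q xs₂ (Unique.filter⁺ (¬? ∘ p'?) u₁) (remaining xs₂ bound)
    return (extend H j j' (λ l → lookup ys (inject≤ l r≤))
      (λ l → sub _ (∈-lookup (inject≤ l r≤)))
      (λ {l} {l'} e → F.inject≤-injective r≤ r≤ l l' (lookup-injective uys _ _ e))
      (λ x∈ → let x∈₁ , ne' = ∈-filter⁻ (¬? ∘ p'?) {xs = xs₁} x∈
                  x∈₀ , ne  = ∈-filter⁻ (¬? ∘ p?) {xs = xs} x∈₁ in x∈₀ , ne , ne'))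
    where
    strict : P * P * r < length xs
    strict = ℕ.≤-trans (ℕ.+-monoˡ-≤ (P * P * r)
      (ℕ.≤-trans 1≤t (ℕ.≤-trans (ℕ.m≤m+n t t) (ℕ.m≤m+n (t + t) (q * (t + t)))))) large

    remaining : ∀ xs₂ → length xs ≤ t + (t + length xs₂) → q * (t + t) + P * P * r ≤ length xs₂
    remaining xs₂ bound = ℕ.+-cancelˡ-≤ (t + t) _ _ (ℕ.≤-trans
      (ℕ.≤-reflexive (≡-sym (ℕ.+-assoc (t + t) (q * (t + t)) (P * P * r))))
      (ℕ.≤-trans large (ℕ.≤-trans bound (ℕ.≤-reflexive (≡-sym (ℕ.+-assoc t t _))))))

    extend : ∀ {xs₂} → HeavyMatching q xs₂ → ∀ j j' (it : Fin r → I) →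
      (∀ l → it l ∈ xs × (p (it l) , p' (it l)) ≡ (j , j')) → (∀ {l l'} → it l ≡ it l' → l ≡ l') →
      (∀ {x} → x ∈ xs₂ → x ∈ xs × p x ≢ j × p' x ≢ j') → HeavyMatching (suc q) xs
    extend H j j' it it∈ it-inj sub = record
      { J        = λ { zero → j ; (suc m) → J m }
      ; J'       = λ { zero → j' ; (suc m) → J' m }
      ; J-inj    = λ { {zero} {zero} _ → refl
                     ; {zero} {suc m'} e → contradiction (≡-sym e) (J≢ m')
                     ; {suc m} {zero} e → contradiction e (J≢ m)
                     ; {suc m} {suc m'} e → cong suc (J-inj e) }
      ; J'-inj   = λ { {zero} {zero} _ → refl
                     ; {zero} {suc m'} e → contradiction (≡-sym e) (J'≢ m')
                     ; {suc m} {zero} e → contradiction e (J'≢ m)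
                     ; {suc m} {suc m'} e → cong suc (J'-inj e) }
      ; item     = λ { zero → it ; (suc m) → item m }
      ; item∈    = λ { zero l → proj₁ (it∈ l) ; (suc m) l → proj₁ (sub (item∈ m l)) }
      ; item-inj = λ { zero → it-inj ; (suc m) → item-inj m }
      ; item-J   = λ { zero l → cong proj₁ (proj₂ (it∈ l)) ; (suc m) → item-J m }
      ; item-J'  = λ { zero l → cong proj₂ (proj₂ (it∈ l)) ; (suc m) → item-J' m }
      }
      where
      open HeavyMatching H
      -- As `r` is positive, each pair of `H` has an item, and that item survived the removal of `j`
      -- and `j'`.
      l₀ : Fin r
      l₀ = inject≤ zero 1≤r
      J≢ : ∀ m → J m ≢ j
      J≢ m e = proj₁ (proj₂ (sub (item∈ m l₀))) (trans (item-J m l₀) e)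
      J'≢ : ∀ m → J' m ≢ j'
      J'≢ m e = proj₂ (proj₂ (sub (item∈ m l₀))) (trans (item-J' m l₀) e)

Walk-map₂ : (∀ {x} → P x → Q x) → (∀ {x y} → P x → P y → R x y → S x y) → Walk P R x y → Walk Q S x y
Walk-map₂ f g (here p)     = here (f p)
Walk-map₂ f g (step p r w) = step (f p) (g p (Walk-start w) r) (Walk-map₂ f g w)

does-true : {A : Set a} (d : Dec A) → does d ≡ true → A
does-true (yes p) _ = p

-- Models from branch sets, and packings

module _ (H G : Graph) where

  -- Regions need not be connected: cores keep remnants of abandoned pieces, and linkage members are
  -- arbitrary sets around a walk. Hence `link` asks for walks from the roots.
  record Branches : Set₁ where
    field
      Region   : Fin (n H) → Fin (n G) → Set
      disjoint : ∀ {h h' x} → Region h x → Region h' x → h ≡ h'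
      root     : Fin (n H) → Fin (n G)
      root∈    : ∀ h → Region h (root h)
      link     : ∀ {h h'} → Edge H h h' → ∃₂ λ x y →
                 Walk (Region h) (Edge G) (root h) x × Walk (Region h') (Edge G) (root h') y × Edge G x y

  -- The branch sets are the components of the roots in their regions.
  branches⇒model : Fin (n H) → (β : Branches) →
    ¬ ¬ ∃ λ S → IsModel H G S × (∀ {x} → x Subset.∈ vs S → ∃ λ h → Branches.Region β h x)
  branches⇒model h₀ β = do
    In? ← ¬¬-Fin λ x → em (∃ λ h → Walk (Region h) (Edge G) (root h) x)
    return (model In?)
    where
    open Branches β

    Branch : Fin (n H) → Fin (n G) → Set
    Branch h = Walk (Region h) (Edge G) (root h)

    In : Fin (n G) → Set
    In x = ∃ λ h → Branch h x

    model : (∀ x → Dec (In x)) → ∃ λ S → IsModel H G S × (∀ {x} → x Subset.∈ vs S → ∃ λ h → Region h x)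
    model In? = K , (φ , onto , conn , edge , linked) , λ x∈ → let h , w = ∈vs⇒In x∈ in h , Walk-end w
      where
      -- `φ` has to be total on the vertices of `G`; outside the branch sets it takes the value
      -- `h₀`.
      pick : ∀ {x} → Dec (In x) → Fin (n H)
      pick (yes (h , _)) = h
      pick (no _)        = h₀

      φ = λ x → pick (In? x)

      pick-≡ : ∀ {h x} → Branch h x → (d : Dec (In x)) → pick d ≡ h
      pick-≡ w (yes (_ , w')) = disjoint (Walk-end w') (Walk-end w)
      pick-≡ w (no ∉)         = contradiction (_ , w) ∉

      φ-≡ : ∀ {h x} → Branch h x → φ x ≡ h
      φ-≡ w = pick-≡ w (In? _)

      -- A model is contracted to `H` without deleting edges, so edges of `G` between branch sets
      -- not adjacent in `H` must stay out of the subgraph.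
      EdgeS : Fin (n G) → Fin (n G) → Set
      EdgeS x y = Edge G x y × (In x × In y) × (φ x ≡ φ y ⊎ Edge H (φ x) (φ y))

      EdgeS-sym : ∀ {x y} → EdgeS x y → EdgeS y x
      EdgeS-sym {x} {y} (e , (p , q) , c) = trans (Graph.sym G y x) e , (q , p) ,
        [ inj₁ ∘ ≡-sym , (λ e' → inj₂ (trans (Graph.sym H _ _) e')) ]′ c

      EdgeS? : ∀ x y → Dec (EdgeS x y)
      EdgeS? x y = (adj G x y Bool.≟ true) ×-dec (In? x ×-dec In? y) ×-dec
                   ((φ x F.≟ φ y) ⊎-dec (adj H (φ x) (φ y) Bool.≟ true))

      V-S : Subset (n G)
      V-S = Vec.tabulate (does ∘ In?)

      ∈vs⇒In : ∀ {x} → x Subset.∈ V-S → In x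
      ∈vs⇒In {x} x∈ = does-true (In? x) (trans (≡-sym (Vec.lookup∘tabulate (does ∘ In?) x)) (Vec.[]=⇒lookup x∈))

      In⇒∈vs : ∀ {x} → In x → x Subset.∈ V-S
      In⇒∈vs {x} p = Vec.lookup⇒[]= x V-S (trans (Vec.lookup∘tabulate (does ∘ In?) x) (dec-true (In? x) p))

      K : Subgraph G
      K = record
        { vs     = V-S
        ; es     = λ x y → does (EdgeS? x y)
        ; es-sym = λ x y → does-⇔ (mk⇔ EdgeS-sym EdgeS-sym) (EdgeS? x y) (EdgeS? y x)
        ; es-sub = λ x y e → let e' , (p , q) , _ = does-true (EdgeS? x y) e in e' , In⇒∈vs p , In⇒∈vs q
        }

      onto : ∀ h → ∃ λ x → x Subset.∈ vs K × φ x ≡ h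
      onto h = root h , In⇒∈vs (h , here (root∈ h)) , φ-≡ (here (root∈ h))

      conn : ∀ x y → x Subset.∈ vs K → y Subset.∈ vs K → φ x ≡ φ y →
        Walk (λ z → z Subset.∈ vs K × φ z ≡ φ x) (λ a b → es K a b ≡ true) x y
      conn x y x∈ y∈ φ≡ with ∈vs⇒In x∈ | ∈vs⇒In y∈
      ... | h , u | h' , v with trans (≡-sym (φ-≡ u)) (trans φ≡ (φ-≡ v))
      ... | refl = Walk-map₂ (λ w → In⇒∈vs (h , w) , trans (φ-≡ w) (≡-sym (φ-≡ u)))
        (λ {x} {y} w w' e → dec-true (EdgeS? x y) (e , ((h , w) , (h , w')) , inj₁ (trans (φ-≡ w) (≡-sym (φ-≡ w')))))
        (Walk-map (u ++ʷ_) id (Walk-reachable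
          (Walk-reverse (λ {x} {y} e → trans (Graph.sym G y x) e) u ++ʷ v)))

      edge : ∀ x y → es K x y ≡ true → φ x ≢ φ y → Edge H (φ x) (φ y)
      edge x y e ne = [ (λ e' → contradiction e' ne) , id ]′ (proj₂ (proj₂ (does-true (EdgeS? x y) e)))

      linked : ∀ h h' → Edge H h h' → ∃ λ x → ∃ λ y → es K x y ≡ true × φ x ≡ h × φ y ≡ h'
      linked h h' e with link e
      ... | x , y , u , v , e' = x , y ,
        dec-true (EdgeS? x y) (e' , ((h , u) , (h' , v)) ,
          inj₂ (subst₂ (Edge H) (≡-sym (φ-≡ u)) (≡-sym (φ-≡ v)) e)) , φ-≡ u , φ-≡ v

  Pack : (Fin (n G) → Set) → ℕ → Set
  Pack U q = Σ (Fin q → Subgraph G) λ F → IsPacking H G q F × (∀ i {x} → x Subset.∈ vs (F i) → U x)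

  Pack-mono : ∀ {U W q} → (∀ {x} → U x → W x) → Pack U q → Pack W q
  Pack-mono f (F , π , sub) = F , π , λ i x∈ → f (sub i x∈)

  Pack-≤ : ∀ {U p q} → p ≤ q → Pack U q → Pack U p
  Pack-≤ p≤q (F , (models , disj) , sub) = (λ i → F (inject≤ i p≤q)) ,
    ((λ i → models _) , λ i j i≢j → disj _ _ λ e → i≢j (F.inject≤-injective p≤q p≤q i j e)) , λ i → sub _

  Pack-0 : ∀ {U} → Pack U 0
  Pack-0 = (λ ()) , ((λ ()) , λ ()) , λ ()

  Pack-1 : ∀ {U} S → IsModel H G S → (∀ {x} → x Subset.∈ vs S → U x) → Pack U 1
  Pack-1 S model sub = (λ _ → S) , ((λ _ → model) , λ { zero zero ne → contradiction refl ne }) , λ _ → sub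

  Pack-∪ : ∀ {U W p q} → (∀ {x} → U x → ¬ W x) → Pack U p → Pack W q → Pack (λ x → U x ⊎ W x) (p + q)
  Pack-∪ {U} {W} {p} {q} disj (F , (mF , dF) , sF) (F' , (mF' , dF') , sF') =
    K ∘ splitAt p , ((λ i → models (splitAt p i)) , λ i j i≢j x → separate (splitAt p i) (splitAt p j)
      (λ e → i≢j (splitAt-injective i j e)) x) , λ i → inside (splitAt p i)
    where
    K : Fin p ⊎ Fin q → Subgraph G
    K = [ F , F' ]′

    models : ∀ i → IsModel H G (K i)
    models (inj₁ i) = mF i
    models (inj₂ i) = mF' i

    inside : ∀ i {x} → x Subset.∈ vs (K i) → U x ⊎ W x
    inside (inj₁ i) = inj₁ ∘ sF i
    inside (inj₂ i) = inj₂ ∘ sF' i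

    separate : ∀ i j → i ≢ j → ∀ x → x Subset.∈ vs (K i) → x Subset.∈ vs (K j) → ⊥
    separate (inj₁ i) (inj₁ j) ne x = dF i j (λ e → ne (cong inj₁ e)) x
    separate (inj₂ i) (inj₂ j) ne x = dF' i j (λ e → ne (cong inj₂ e)) x
    separate (inj₁ i) (inj₂ j) _ x x∈ x∈' = disj (sF i x∈) (sF' j x∈')
    separate (inj₂ i) (inj₁ j) _ x x∈ x∈' = disj (sF j x∈') (sF' i x∈)

    splitAt-injective : ∀ i j → splitAt p i ≡ splitAt p j → i ≡ j
    splitAt-injective i j e = trans (≡-sym (F.join-splitAt p q i)) (trans (cong (Fin.join p q) e) (F.join-splitAt p q j))

  Pack-branches : ∀ {q U} → Fin (n H) → (β : Fin q → Branches) →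
    (∀ {i j h h' x} → Branches.Region (β i) h x → Branches.Region (β j) h' x → i ≡ j) →
    (∀ {i h x} → Branches.Region (β i) h x → U x) → ¬ ¬ Pack U q
  Pack-branches h₀ β disj sub = do
    S ← ¬¬-Fin λ i → branches⇒model h₀ (β i)
    return (proj₁ ∘ S , ((λ i → proj₁ (proj₂ (S i))) ,
      λ i j i≢j x x∈ x∈' → i≢j (disj (proj₂ (proj₂ (proj₂ (S i)) x∈)) (proj₂ (proj₂ (proj₂ (S j)) x∈')))) ,
      λ i {x} x∈ → sub (proj₂ (proj₂ (proj₂ (S i)) x∈)))

-- Exploring the big component

-- `Big C` will mean that `C` packs more than `h` models. `s` is the room for a cut, beside one
-- vertex for each of the `2 * (P * suc t)` labels.
module Exploration
  (G : Graph) (U : Fin (n G) → Set) (P t s : ℕ)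
  (Big : (Fin (n G) → Set) → Set)
  (Big-mono : ∀ {C D} → (∀ {x} → C x → D x) → Big C → Big D)
  (Big-meet : ∀ {C D} → (∀ {x} → C x → U x) → (∀ {x} → D x → U x) →
    Big C → Big D → ¬ ¬ ∃ λ x → C x × D x)
  (bigComponent : ∀ X → length X ≤ 2 * (P * suc t) + s →
    ¬ ¬ ∃ λ x → Big (Walk (Avoid U X) (Edge G) x))
  where

  private
    V₀ = Fin (n G)

  E : V₀ → V₀ → Set
  E = Edge G

  E-sym : ∀ {x y} → E x y → E y x
  E-sym {x} {y} e = trans (Defs.sym G y x) e

  Label : Set
  Label = Fin 2 × Fin P × Fin (suc t)

  pattern core b j   = b , j , zero
  pattern leaf b j i = b , j , suc i

  code : Label → Fin (2 * (P * suc t))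
  code (b , j , l) = combine b (combine j l)

  code-injective : ∀ {ℓ ℓ'} → code ℓ ≡ code ℓ' → ℓ ≡ ℓ'
  code-injective {b , j , l} {b' , j' , l'} e
    with refl , e' ← F.combine-injective b (combine j l) b' (combine j' l') e
    with refl , refl ← F.combine-injective j l j' l' e' = refl

  data Role : Set where
    dead inside : Role
    lab         : Label → Role

  lab-injective : ∀ {ℓ ℓ'} → lab ℓ ≡ lab ℓ' → ℓ ≡ ℓ'
  lab-injective refl = refl

  -- The big connected set C still to be explored is seen only by labelled vertices, at most one
  -- per label. For each b and j, the vertices core b j lead from a root ρ b j to the leaves leaf b j i.
  record State : Set where
    field
      role : V₀ → Role
      ρ    : Fin 2 → Fin P → V₀

    C : V₀ → Set
    C x = role x ≡ inside

    Touches : V₀ → Set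
    Touches x = ∃ λ c → C c × E c x

    Core : Fin 2 → Fin P → V₀ → Set
    Core b j x = role x ≡ lab (core b j)

    field
      inU       : ∀ {x} → role x ≢ dead → U x
      connected : ∀ {x y} → C x → C y → Walk C E x y
      sealed    : ∀ {x} → Touches x → U x → role x ≢ dead
      -- Vertices that have lost contact with `C` may keep their labels, so the conditions on labels
      -- are restricted to vertices touching `C`.
      injective : ∀ {x y ℓ} → Touches x → Touches y → role x ≡ lab ℓ → role y ≡ lab ℓ → x ≡ y
      rootCore  : ∀ {x b j} → Touches x → Core b j x → Walk (Core b j) E (ρ b j) x
      rootLeaf  : ∀ {x b j i} → Touches x → role x ≡ lab (leaf b j i) →
                  ∃ λ z → Walk (Core b j) E (ρ b j) z × E z x
      big       : Big C

    Leaf : Fin 2 → V₀ → Set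
    Leaf b x = Touches x × ∃₂ λ j i → role x ≡ lab (leaf b j i)

    -- Cores are left out, so that a linkage in `Field` is disjoint from the pieces that it joins.
    Field : V₀ → Set
    Field x = C x ⊎ ∃ λ b → Leaf b x

    Full : Set
    Full = ∀ b j i → ∃ λ x → Touches x × role x ≡ lab (leaf b j i)

    C⇒U : ∀ {x} → C x → U x
    C⇒U Cx = inU λ e → contradiction (trans (≡-sym Cx) e) λ ()

    lab⇒U : ∀ {x ℓ} → role x ≡ lab ℓ → U x
    lab⇒U rx = inU λ e → contradiction (trans (≡-sym rx) e) λ ()

    C⇒¬lab : ∀ {x ℓ} → C x → role x ≢ lab ℓ
    C⇒¬lab Cx rx = contradiction (trans (≡-sym Cx) rx) λ ()

    Field⇒¬core : ∀ {x b j} → Field x → role x ≢ lab (core b j)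
    Field⇒¬core (inj₁ Cx) rx = C⇒¬lab Cx rx
    Field⇒¬core (inj₂ (_ , _ , _ , _ , rx)) rx' = contradiction (trans (≡-sym rx) rx') λ ()

    Field⇒U : ∀ {x} → Field x → U x
    Field⇒U (inj₁ Cx) = C⇒U Cx
    Field⇒U (inj₂ (_ , _ , _ , _ , rx)) = lab⇒U rx

  record Cut (σ : State) (Z : List V₀) : Set₁ where
    open State σ
    field
      C'         : V₀ → Set
      C'⊆C       : ∀ {x} → C' x → C x
      C'∌Z       : ∀ {x} → C' x → x ∉ Z
      connected' : ∀ {x y} → C' x → C' y → Walk C' E x y
      closed     : ∀ {x y} → C' x → E x y → C y → y ∉ Z → C' y
      big'       : Big C'

  bag : (σ : State) → let open State σ in
    ¬ ¬ ∃ λ X → length X ≤ 2 * (P * suc t) × (∀ x → C x → x ∉ X) ×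
                (∀ x ℓ → Touches x → role x ≡ lab ℓ → x ∈ X)
  bag σ = do
    X , uniq , sound , complete ← comprehension (λ x → Touches x × ∃ λ ℓ → role x ≡ lab ℓ)
    let label = λ i → proj₂ (sound (lookup X i) (∈-lookup i))
    return ( X
           , F.injective⇒≤ {f = λ i → code (proj₁ (label i))} (λ {i} {j} e →
               lookup-injective uniq i j (injective (proj₁ (sound _ (∈-lookup i))) (proj₁ (sound _ (∈-lookup j)))
                 (proj₂ (label i)) (trans (proj₂ (label j)) (cong lab (≡-sym (code-injective e))))))
           , (λ x Cx x∈ → C⇒¬lab Cx (proj₂ (proj₂ (sound _ x∈))))
           , λ x ℓ tx rx → complete x (tx , ℓ , rx) )
    where open State σ

  -- To leave `C`, the new component would have to enter a vertex of `U` touching `C`; by `sealed`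
  -- that vertex is labelled, hence deleted with the bag.
  cut : (σ : State) (Z : List V₀) → length Z ≤ s → ¬ ¬ Cut σ Z
  cut σ Z Z≤s = do
    X , X≤ , C∌X , seen ← bag σ
    x₀ , big' ← bigComponent (X ++ Z) (subst (_≤ _) (≡-sym (L.length-++ X)) (ℕ.+-mono-≤ X≤ Z≤s))
    z , Cz , w ← Big-meet C⇒U (λ w → proj₁ (Walk-end w)) big big'
    let C' = Walk (Avoid U (X ++ Z)) E x₀
        stay : ∀ {x y} → C x → Avoid U (X ++ Z) x → E x y → Avoid U (X ++ Z) y → C y
        stay = λ {x} {y} Cx _ e (Uy , y∉) → stays Cx e Uy (λ ty ry → y∉ (∈-++⁺ˡ (seen _ _ ty ry)))
        back = λ {x y} (u : C' x) (v : C' y) → Walk-reverse E-sym u ++ʷ v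
    return record
      { C'         = C'
      ; C'⊆C       = λ v → proj₂ (Walk-end (Walk-invariant stay Cz (back w v)))
      ; C'∌Z       = λ v x∈Z → proj₂ (Walk-end v) (∈-++⁺ʳ X x∈Z)
      ; connected' = λ u v → Walk-map (u ++ʷ_) id (Walk-reachable (back u v))
      ; closed     = λ v e Cy y∉Z → Walk-snoc v e (C⇒U Cy , [ C∌X _ Cy , y∉Z ]′ ∘ ∈-++⁻ X)
      ; big'       = big'
      }
    where
    open State σ
    stays : ∀ {x y} → C x → E x y → U y → (∀ {ℓ} → Touches y → role y ≢ lab ℓ) → C y
    stays {x} {y} Cx e Uy ¬lab with role y in ry
    ... | dead   = contradiction ry (sealed (x , Cx , e) Uy)
    ... | inside = refl
    ... | lab ℓ  = contradiction refl (¬lab (x , Cx , e))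

  -- The bookkeeping shared by all steps. `new-Z` preserves `sealed`: by `closed`, a vertex of `C`
  -- outside `C'` that touches `C'` lies in `Z`, so it gets a label. The other vertices lost by `C`
  -- may die.
  module Relabel
    (σ : State) (Z : List V₀) (κ : Cut σ Z)
    (C'? : ∀ x → Dec (Cut.C' κ x)) (new : V₀ → Maybe Label)
    (new-Z : ∀ {x} → x ∈ Z → State.C σ x → new x ≢ nothing)
    (new-U : ∀ {x ℓ} → new x ≡ just ℓ → U x)
    where

    open State σ
    open Cut κ

    relabel : ∀ {X : Set} → Dec X → Maybe Label → Role → Role
    relabel (yes _) _        _      = inside
    relabel (no _)  (just ℓ) _      = lab ℓ
    relabel (no _)  nothing  inside = dead
    relabel (no _)  nothing  o      = o

    role' : V₀ → Role
    role' x = relabel (C'? x) (new x) (role x)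

    inside⇒C' : ∀ {x} → role' x ≡ inside → C' x
    inside⇒C' {x} e with C'? x | new x | role x
    ... | yes c | _ | _ = c
    inside⇒C' () | no _ | just _  | _
    inside⇒C' () | no _ | nothing | dead
    inside⇒C' () | no _ | nothing | inside
    inside⇒C' () | no _ | nothing | lab _

    C'⇒inside : ∀ {x} → C' x → role' x ≡ inside
    C'⇒inside {x} c with C'? x
    ... | yes _ = refl
    ... | no ¬c = contradiction c ¬c

    new⇒lab : ∀ {x ℓ} → ¬ C' x → new x ≡ just ℓ → role' x ≡ lab ℓ
    new⇒lab {x} ¬c e with C'? x
    ... | yes c = contradiction c ¬c
    ... | no _ rewrite e = refl

    old⇒lab : ∀ {x ℓ} → new x ≡ nothing → role x ≡ lab ℓ → role' x ≡ lab ℓ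
    old⇒lab {x} e rx with C'? x
    ... | yes c = contradiction rx (C⇒¬lab (C'⊆C c))
    ... | no _ rewrite e | rx = refl

    lab⇒ : ∀ {x ℓ} → role' x ≡ lab ℓ → new x ≡ just ℓ ⊎ (new x ≡ nothing × role x ≡ lab ℓ)
    lab⇒ {x} e with C'? x | new x | role x
    lab⇒ ()   | yes _ | _       | _
    lab⇒ refl | no _  | just _  | _      = inj₁ refl
    lab⇒ ()   | no _  | nothing | dead
    lab⇒ ()   | no _  | nothing | inside
    lab⇒ refl | no _  | nothing | lab _  = inj₂ (refl , refl)

    dead⇒ : ∀ {x} → role' x ≡ dead → ¬ C' x × new x ≡ nothing × (C x ⊎ role x ≡ dead)
    dead⇒ {x} e with C'? x | new x | role x
    dead⇒ ()   | yes _ | _       | _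
    dead⇒ ()   | no _  | just _  | _
    dead⇒ refl | no ¬c | nothing | dead   = ¬c , refl , inj₂ refl
    dead⇒ refl | no ¬c | nothing | inside = ¬c , refl , inj₁ refl
    dead⇒ ()   | no _  | nothing | lab _

    Touches' : V₀ → Set
    Touches' x = ∃ λ c → C' c × E c x

    weaken : ∀ {x} → Touches' x → Touches x
    weaken (c , c' , e) = c , C'⊆C c' , e

    Core' : Fin 2 → Fin P → V₀ → Set
    Core' b j x = role' x ≡ lab (core b j)

    advance : (ρ' : Fin 2 → Fin P → V₀) →
      (∀ {x y ℓ} → Touches' x → Touches' y → role' x ≡ lab ℓ → role' y ≡ lab ℓ → x ≡ y) →
      (∀ {x b j} → Touches' x → Core' b j x → Walk (Core' b j) E (ρ' b j) x) →
      (∀ {x b j i} → Touches' x → role' x ≡ lab (leaf b j i) →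
        ∃ λ z → Walk (Core' b j) E (ρ' b j) z × E z x) →
      ∃ λ σ' → ∀ {x} → State.C σ' x → C' x
    advance ρ' inj rc rl = record
      { role      = role'
      ; ρ         = ρ'
      ; inU       = inU'
      ; connected = λ u v → Walk-map C'⇒inside id (connected' (inside⇒C' u) (inside⇒C' v))
      ; sealed    = λ τ Ux e → sealed' (down τ) Ux (dead⇒ e)
      ; injective = λ τ τ' → inj (down τ) (down τ')
      ; rootCore  = rc ∘ down
      ; rootLeaf  = rl ∘ down
      ; big       = Big-mono C'⇒inside big'
      } , inside⇒C'
      where
      down : ∀ {x} → (∃ λ c → role' c ≡ inside × E c x) → Touches' x
      down (c , e , r) = c , inside⇒C' e , r

      inU' : ∀ {x} → role' x ≢ dead → U x
      inU' {x} ne with role' x in rx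
      ... | dead   = contradiction refl ne
      ... | inside = C⇒U (C'⊆C (inside⇒C' rx))
      ... | lab ℓ  = [ new-U , lab⇒U ∘ proj₂ ]′ (lab⇒ rx)

      sealed' : ∀ {x} → Touches' x → U x → ¬ (¬ C' x × new x ≡ nothing × (C x ⊎ role x ≡ dead))
      sealed' τ Ux (_ , _ , inj₂ d) = sealed (weaken τ) Ux d
      sealed' (c , c' , r) Ux (¬c , e , inj₁ Cx) = ¬c (closed c' r Cx λ x∈Z → new-Z x∈Z Cx e)

  -- Growing and restarting pieces

  Shrinks : State → Set
  Shrinks σ = ∃ λ σ' → (∀ {x} → State.C σ' x → State.C σ x) × ∃ λ z → State.C σ z × ¬ State.C σ' z

  -- `u` becomes the new leaf. If `v` is a leaf, it is promoted to the core; by `onlyV` this leaves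
  -- at most one core vertex of the piece in touch with `C`. The walk to `v` admits `v` itself,
  -- which may not carry the core label yet.
  extend : 1 ≤ s → (σ : State) (let open State σ) {b : Fin 2} {j : Fin P} {i : Fin t} {u v : V₀} →
    C u → E u v →
    role v ≡ lab (core b j) ⊎ (∃ λ i' → role v ≡ lab (leaf b j i')) →
    (∀ {y} → Touches y → Core b j y → y ≡ v) →
    Walk (λ x → Core b j x ⊎ x ≡ v) E (ρ b j) v →
    (∀ {x} → Touches x → role x ≢ lab (leaf b j i)) →
    ¬ ¬ Shrinks σ
  extend 1≤s σ {b} {j} {i} {u} {v} Cu uv rv onlyV rooted free = do
    κ ← cut σ (u ∷ []) 1≤s
    C'? ← ¬¬-Fin λ x → em (Cut.C' κ x)
    return (shrunk κ C'?)
    where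
    open State σ

    new : V₀ → Maybe Label
    new x with x F.≟ u | x F.≟ v
    ... | yes _ | _     = just (leaf b j i)
    ... | no _  | yes _ = just (core b j)
    ... | no _  | no _  = nothing

    new-u : ∀ {x} → x ≡ u → new x ≡ just (leaf b j i)
    new-u {x} e with x F.≟ u | x F.≟ v
    ... | yes _ | _ = refl
    ... | no ne | _ = contradiction e ne

    ¬Cv : ¬ C v
    ¬Cv Cv = [ C⇒¬lab Cv , (λ (_ , e) → C⇒¬lab Cv e) ]′ rv

    new-v : ∀ {x} → x ≡ v → new x ≡ just (core b j)
    new-v {x} e with x F.≟ u | x F.≟ v
    ... | yes refl | _ = contradiction (subst C e Cu) ¬Cv
    ... | no _ | yes _ = refl
    ... | no _ | no ne = contradiction e ne

    new-old : ∀ {x} → x ≢ u → x ≢ v → new x ≡ nothing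
    new-old {x} nu nv with x F.≟ u | x F.≟ v
    ... | yes e | _     = contradiction e nu
    ... | no _  | yes e = contradiction e nv
    ... | no _  | no _  = refl

    new⇒ : ∀ {x ℓ} → new x ≡ just ℓ → (x ≡ u × ℓ ≡ leaf b j i) ⊎ (x ≡ v × ℓ ≡ core b j)
    new⇒ {x} e with x F.≟ u | x F.≟ v
    new⇒ refl | yes e | _     = inj₁ (e , refl)
    new⇒ refl | no _  | yes e = inj₂ (e , refl)

    new-Z : ∀ {x} → x ∈ u ∷ [] → C x → new x ≢ nothing
    new-Z (here e) _ ne = contradiction (trans (≡-sym (new-u e)) ne) λ ()

    new-U : ∀ {x ℓ} → new x ≡ just ℓ → U x
    new-U e with new⇒ e
    ... | inj₁ (refl , _) = C⇒U Cu
    ... | inj₂ (refl , _) = [ lab⇒U , lab⇒U ∘ proj₂ ]′ rv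

    shrunk : (κ : Cut σ (u ∷ [])) → (∀ x → Dec (Cut.C' κ x)) → Shrinks σ
    shrunk κ C'? = proj₁ next , (C'⊆C ∘ proj₂ next) , u , Cu , λ c → C'∌Z (proj₂ next c) (here refl)
      where
      open Cut κ
      open Relabel σ (u ∷ []) κ C'? new new-Z new-U

      core-v : Core' b j v
      core-v = new⇒lab (¬Cv ∘ C'⊆C) (new-v refl)

      keep : ∀ {b' j' x} → Core b' j' x → Core' b' j' x
      keep {b'} {j'} {x} rx = by-cases (x F.≟ u) (x F.≟ v)
        where
        by-cases : Dec (x ≡ u) → Dec (x ≡ v) → Core' b' j' x
        by-cases (yes refl) _ = contradiction rx (C⇒¬lab Cu)
        by-cases (no nu) (no nv) = old⇒lab (new-old nu nv) rx
        by-cases (no _) (yes refl) = [ same , (λ (_ , rv') → contradiction (trans (≡-sym rx) rv') λ ()) ]′ rv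
          where
          same : role v ≡ lab (core b j) → Core' b' j' v
          same rv' with refl ← lab-injective (trans (≡-sym rx) rv') = core-v

      Origin : V₀ → Label → Set
      Origin x ℓ = (x ≡ u × ℓ ≡ leaf b j i) ⊎ (x ≡ v × ℓ ≡ core b j) ⊎ role x ≡ lab ℓ

      origin : ∀ {x ℓ} → role' x ≡ lab ℓ → Origin x ℓ
      origin e with lab⇒ e
      ... | inj₂ (_ , rx) = inj₂ (inj₂ rx)
      ... | inj₁ e' with new⇒ e'
      ... | inj₁ p = inj₁ p
      ... | inj₂ p = inj₂ (inj₁ p)

      inj' : ∀ {x y ℓ} → Touches' x → Touches' y → Origin x ℓ → Origin y ℓ → x ≡ y
      inj' τ τ' (inj₁ (refl , refl)) (inj₁ (refl , _)) = refl
      inj' τ τ' (inj₁ (refl , refl)) (inj₂ (inj₁ (_ , ())))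
      inj' τ τ' (inj₁ (refl , refl)) (inj₂ (inj₂ ry)) = contradiction ry (free (weaken τ'))
      inj' τ τ' (inj₂ (inj₁ (refl , refl))) (inj₁ (_ , ()))
      inj' τ τ' (inj₂ (inj₁ (refl , refl))) (inj₂ (inj₁ (refl , _))) = refl
      inj' τ τ' (inj₂ (inj₁ (refl , refl))) (inj₂ (inj₂ ry)) = ≡-sym (onlyV (weaken τ') ry)
      inj' τ τ' (inj₂ (inj₂ rx)) (inj₁ (refl , refl)) = contradiction rx (free (weaken τ))
      inj' τ τ' (inj₂ (inj₂ rx)) (inj₂ (inj₁ (refl , refl))) = onlyV (weaken τ) rx
      inj' τ τ' (inj₂ (inj₂ rx)) (inj₂ (inj₂ ry)) = injective (weaken τ) (weaken τ') rx ry

      root-v : Walk (Core' b j) E (ρ b j) v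
      root-v = Walk-map [ keep , (λ { refl → core-v }) ]′ id rooted

      rc : ∀ {x b' j'} → Touches' x → Origin x (core b' j') → Walk (Core' b' j') E (ρ b' j') x
      rc τ (inj₂ (inj₁ (refl , refl))) = root-v
      rc τ (inj₂ (inj₂ rx)) = Walk-map keep id (rootCore (weaken τ) rx)

      rl : ∀ {x b' j' i'} → Touches' x → Origin x (leaf b' j' i') →
        ∃ λ z → Walk (Core' b' j') E (ρ b' j') z × E z x
      rl τ (inj₁ (refl , refl)) = v , root-v , E-sym uv
      rl τ (inj₂ (inj₂ rx)) with rootLeaf (weaken τ) rx
      ... | z , w , e = z , Walk-map keep id w , e

      next = advance ρ (λ τ τ' ex ey → inj' τ τ' (origin ex) (origin ey))
               (λ τ e → rc τ (origin e)) (λ τ e → rl τ (origin e))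

  -- The piece has lost contact with `C`, so its labels are free again: it is abandoned and
  -- restarted with `u` as root. Its old vertices stay labelled.
  reset : 1 ≤ s → (σ : State) (let open State σ) {b : Fin 2} {j : Fin P} {u : V₀} → C u →
    (∀ {x l} → Touches x → role x ≢ lab (b , j , l)) → ¬ ¬ Shrinks σ
  reset 1≤s σ {b} {j} {u} Cu free = do
    κ ← cut σ (u ∷ []) 1≤s
    C'? ← ¬¬-Fin λ x → em (Cut.C' κ x)
    return (shrunk κ C'?)
    where
    open State σ

    new : V₀ → Maybe Label
    new x with x F.≟ u
    ... | yes _ = just (core b j)
    ... | no _  = nothing

    new-u : new u ≡ just (core b j)
    new-u with u F.≟ u
    ... | yes _ = refl
    ... | no ne = contradiction refl ne

    new-old : ∀ {x} → x ≢ u → new x ≡ nothing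
    new-old {x} nu with x F.≟ u
    ... | yes e = contradiction e nu
    ... | no _  = refl

    new⇒ : ∀ {x ℓ} → new x ≡ just ℓ → x ≡ u × ℓ ≡ core b j
    new⇒ {x} e with x F.≟ u
    new⇒ refl | yes e = e , refl

    new-Z : ∀ {x} → x ∈ u ∷ [] → C x → new x ≢ nothing
    new-Z (here refl) _ ne = contradiction (trans (≡-sym new-u) ne) λ ()

    new-U : ∀ {x ℓ} → new x ≡ just ℓ → U x
    new-U e = subst U (≡-sym (proj₁ (new⇒ e))) (C⇒U Cu)

    ρ' : Fin 2 → Fin P → V₀
    ρ' b' j' with b F.≟ b' | j F.≟ j'
    ... | yes _ | yes _ = u
    ... | _     | _     = ρ b' j'

    ρ'-new : ρ' b j ≡ u
    ρ'-new with b F.≟ b | j F.≟ j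
    ... | yes _ | yes _ = refl
    ... | no ne | _     = contradiction refl ne
    ... | yes _ | no ne = contradiction refl ne

    ρ'-old : ∀ {b' j' x l} → Touches x → role x ≡ lab (b' , j' , l) → ρ' b' j' ≡ ρ b' j'
    ρ'-old {b'} {j'} τ rx with b F.≟ b' | j F.≟ j'
    ... | yes refl | yes refl = contradiction rx (free τ)
    ... | no _     | _        = refl
    ... | yes _    | no _     = refl

    shrunk : (κ : Cut σ (u ∷ [])) → (∀ x → Dec (Cut.C' κ x)) → Shrinks σ
    shrunk κ C'? = proj₁ next , (C'⊆C ∘ proj₂ next) , u , Cu , λ c → C'∌Z (proj₂ next c) (here refl)
      where
      open Cut κ
      open Relabel σ (u ∷ []) κ C'? new new-Z new-U

      core-u : Core' b j u
      core-u = new⇒lab (λ c → C'∌Z c (here refl)) new-u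

      keep : ∀ {b' j' x} → Core b' j' x → Core' b' j' x
      keep {b'} {j'} {x} rx = old⇒lab (new-old λ { refl → C⇒¬lab Cu rx }) rx

      Origin : V₀ → Label → Set
      Origin x ℓ = (x ≡ u × ℓ ≡ core b j) ⊎ role x ≡ lab ℓ

      origin : ∀ {x ℓ} → role' x ≡ lab ℓ → Origin x ℓ
      origin e = [ inj₁ ∘ new⇒ , inj₂ ∘ proj₂ ]′ (lab⇒ e)

      inj' : ∀ {x y ℓ} → Touches' x → Touches' y → Origin x ℓ → Origin y ℓ → x ≡ y
      inj' τ τ' (inj₁ (refl , _))    (inj₁ (refl , _))    = refl
      inj' τ τ' (inj₁ (refl , refl)) (inj₂ ry)            = contradiction ry (free (weaken τ'))
      inj' τ τ' (inj₂ rx)            (inj₁ (refl , refl)) = contradiction rx (free (weaken τ))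
      inj' τ τ' (inj₂ rx)            (inj₂ ry)            = injective (weaken τ) (weaken τ') rx ry

      rc : ∀ {x b' j'} → Touches' x → Origin x (core b' j') → Walk (Core' b' j') E (ρ' b' j') x
      rc τ (inj₁ (refl , refl)) = Walk-from ρ'-new (here core-u)
      rc τ (inj₂ rx) = Walk-from (ρ'-old (weaken τ) rx) (Walk-map keep id (rootCore (weaken τ) rx))

      rl : ∀ {x b' j' i'} → Touches' x → Origin x (leaf b' j' i') →
        ∃ λ z → Walk (Core' b' j') E (ρ' b' j') z × E z x
      rl τ (inj₂ rx) with rootLeaf (weaken τ) rx
      ... | z , w , e = z , Walk-from (ρ'-old (weaken τ) rx) (Walk-map keep id w) , e

      next = advance ρ' (λ τ τ' ex ey → inj' τ τ' (origin ex) (origin ey))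
               (λ τ e → rc τ (origin e)) (λ τ e → rl τ (origin e))

  -- The vertex to grow from is a core vertex touching `C`, failing that a leaf, failing that a
  -- fresh root. The last two cases need not increase the number of filled slots; progress is
  -- measured by `C` alone.
  grow : 1 ≤ s → (σ : State) (let open State σ) (b : Fin 2) (j : Fin P) (i : Fin t) →
    ¬ (∃ λ x → Touches x × role x ≡ lab (leaf b j i)) → ¬ ¬ Shrinks σ
  grow 1≤s σ b j i unfilled = do
    no ¬core ← em (∃ λ v → Touches v × role v ≡ lab (core b j))
      where
      yes (v , τ@(u , Cu , uv) , rv) → extend 1≤s σ Cu uv (inj₁ rv) (λ τ' ry → injective τ' τ ry rv)
        (Walk-map inj₁ id (rootCore τ rv)) (λ τ' rx → unfilled (_ , τ' , rx))
    no ¬leaf ← em (∃₂ λ v i' → Touches v × role v ≡ lab (leaf b j i'))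
      where
      yes (v , i' , τ@(u , Cu , uv) , rv) →
        let z , w , e = rootLeaf τ rv
        in extend 1≤s σ Cu uv (inj₂ (i' , rv)) (λ τ' ry → contradiction (_ , τ' , ry) ¬core)
             (Walk-snoc (Walk-map inj₁ id w) e (inj₂ refl)) (λ τ' rx → unfilled (_ , τ' , rx))
    -- A big set meets itself, hence has a vertex.
    u , Cu , _ ← Big-meet C⇒U C⇒U big big
    reset 1≤s σ Cu λ { {x} {zero} τ rx → ¬core (x , τ , rx) ; {x} {suc i'} τ rx → ¬leaf (x , i' , τ , rx) }
    where open State σ

  -- Moving leaves onto a cut

  edges : List (V₀ × V₀)
  edges = filter (λ (x , y) → adj G x y Bool.≟ true) (cartesianProduct (allFin (n G)) (allFin (n G)))

  E⇒Adj : ∀ {x y} → E x y → Adj edges x y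
  E⇒Adj {x} {y} e = inj₁ (∈-filter⁺ _ (∈-cartesianProduct⁺ (∈-allFin x) (∈-allFin y)) e)

  Adj⇒E : ∀ {x y} → Adj edges x y → E x y
  Adj⇒E = [ edge , E-sym ∘ edge ]′
    where
    edge : ∀ {x y} → (x , y) ∈ edges → E x y
    edge p = proj₂ (∈-filter⁻ (λ (x , y) → adj G x y Bool.≟ true) {xs = cartesianProduct (allFin (n G)) (allFin (n G))} p)

  other : Fin 2 → Fin 2
  other zero       = suc zero
  other (suc zero) = zero

  same-or-other : ∀ b b' → b' ≡ b ⊎ b' ≡ other b
  same-or-other zero       zero       = inj₁ refl
  same-or-other zero       (suc zero) = inj₂ refl
  same-or-other (suc zero) zero       = inj₂ refl
  same-or-other (suc zero) (suc zero) = inj₁ refl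

  -- Routing the leaves on side b through a linkage to the cut Z makes the vertices of Z the new leaves,
  -- provided that no old leaf outside Z touches what is left of C.
  push : (σ : State) (let open State σ) (b : Fin 2) (Z : List V₀) →
    Separates edges Field (Leaf b) (Leaf (other b)) Z →
    Linkage edges (λ x → Field x × (Reached edges Field (Leaf b) Z x ⊎ x ∈ Z)) (Leaf b) (_∈ Z) (length Z) →
    (κ : Cut σ Z) → (∀ {x} → Leaf b x → x ∉ Z → ¬ ∃ λ c → Cut.C' κ c × E c x) →
    (∃ λ z → z ∈ Z × C z) → ¬ ¬ Shrinks σ
  push σ b Z sep Λ κ ¬touch (z₀ , z₀∈Z , Cz₀) = do
    C'? ← ¬¬-Fin λ x → em (Cut.C' κ x)
    new ← ¬¬-Fin renewed
    return (shrunk C'? (proj₁ ∘ new) (proj₂ ∘ new))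
    where
    open State σ
    open Cut κ
    open Linkage Λ
    open Bijective (bijective tgt Z tgt-injective tgt∈ refl) using (preimage)

    piece : Fin (length Z) → Fin P
    piece i = proj₁ (proj₂ (src∈ i))

    slot : Fin (length Z) → Fin t
    slot i = proj₁ (proj₂ (proj₂ (src∈ i)))

    role-src : ∀ i → role (src i) ≡ lab (leaf b (piece i) (slot i))
    role-src i = proj₂ (proj₂ (proj₂ (src∈ i)))

    -- A vertex of `Z` inherits the leaf label of the member ending there; the other vertices of the
    -- member join the core of the piece it starts from.
    data New (x : V₀) : Maybe Label → Set where
      end : ∀ i → tgt i ≡ x → New x (just (leaf b (piece i) (slot i)))
      mid : ∀ i → M i x → x ∉ Z → New x (just (core b (piece i)))
      off : (∀ i → ¬ M i x) → x ∉ Z → New x nothing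

    renewed : ∀ x → ¬ ¬ ∃ (New x)
    renewed x = do
      no x∉Z ← em (x ∈ Z)
        where yes x∈Z → let i , e = preimage x∈Z in return (_ , end i e)
      no ¬M ← em (∃ λ i → M i x)
        where yes (i , m) → return (_ , mid i m x∉Z)
      return (nothing , off (λ i m → ¬M (i , m)) x∉Z)

    Near : V₀ → Set
    Near = Reached edges Field (Leaf b) Z

    -- A near vertex of `C` touching `C'` would belong to `C'` by `closed`; a leaf on side `b` is
    -- excluded by `¬touch`; a leaf on the other side would be reached around `Z`.
    near-¬touch : ∀ {x} → Near x → ¬ C' x → ¬ ∃ λ c → C' c × E c x
    near-¬touch (a , La , w) ¬C'x (c , C'c , e) with Walk-end w
    ... | inj₁ Cx , x∉Z = ¬C'x (closed C'c e Cx x∉Z)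
    ... | inj₂ (b' , Lx) , x∉Z with same-or-other b b'
    ... | inj₁ refl = ¬touch Lx x∉Z (c , C'c , e)
    ... | inj₂ refl = sep La Lx w

    -- The walk starts at a leaf, outside `C'`, and by `near-¬touch` no step enters `C'`. This
    -- permits any number of new core vertices: none of them touches `C'`.
    near-¬C' : ∀ {x} → Near x → ¬ C' x
    near-¬C' (a , La , w) = proj₂ (proj₂ (Walk-end (Walk-invariant {Q = λ x → Near x × ¬ C' x} along
      ((a , La , here (Walk-start w)) , λ C'a → C⇒¬lab (C'⊆C C'a) (proj₂ (proj₂ (proj₂ La)))) w)))
      where
      along : ∀ {x y} → Near x × ¬ C' x → Avoid Field Z x → Adj edges x y → Avoid Field Z y → Near y × ¬ C' y
      along (near@(a , La , w) , ¬C'x) _ r p =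
        (a , La , Walk-snoc w r p) , λ C'y → near-¬touch near ¬C'x (_ , C'y , E-sym (Adj⇒E r))

    M⇒near : ∀ {i x} → M i x → x ∉ Z → Near x
    M⇒near m x∉Z = [ id , (λ x∈Z → contradiction x∈Z x∉Z) ]′ (proj₂ (M⊆W m))

    -- There are as many members as vertices of `Z`, so each of these is the end of some member, and
    -- disjointness leaves a member no other one.
    M∩Z : ∀ {i x} → M i x → x ∈ Z → x ≡ tgt i
    M∩Z {i} m x∈Z with preimage x∈Z
    ... | i' , refl = cong tgt (disjoint (M-tgt i') m)

    shrunk : (∀ x → Dec (C' x)) → (new : V₀ → Maybe Label) → (∀ x → New x (new x)) → Shrinks σ
    shrunk C'? new spec = proj₁ next , (C'⊆C ∘ proj₂ next) , z₀ , Cz₀ , λ c → C'∌Z (proj₂ next c) z₀∈Z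
      where
      new-Z : ∀ {x m} → New x m → x ∈ Z → m ≢ nothing
      new-Z (off _ x∉Z) x∈Z _ = x∉Z x∈Z

      new-U : ∀ {x m ℓ} → New x m → m ≡ just ℓ → U x
      new-U (end i refl) _ = Field⇒U (proj₁ (M⊆W (M-tgt i)))
      new-U (mid i m _)  _ = Field⇒U (proj₁ (M⊆W m))

      open Relabel σ Z κ C'? new (λ {x} x∈Z _ → new-Z (spec x) x∈Z) (λ {x} → new-U (spec x))

      data Origin (x : V₀) : Label → Set where
        end : ∀ i → tgt i ≡ x → Origin x (leaf b (piece i) (slot i))
        mid : ∀ i → M i x → x ∉ Z → Origin x (core b (piece i))
        old : ∀ {ℓ} → (∀ i → ¬ M i x) → role x ≡ lab ℓ → Origin x ℓ

      origin : ∀ {x ℓ} → role' x ≡ lab ℓ → Origin x ℓ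
      origin {x} e with new x | spec x | lab⇒ e
      ... | _ | end i eq    | inj₁ refl     = end i eq
      ... | _ | mid i m x∉Z | inj₁ refl     = mid i m x∉Z
      ... | _ | off ¬M _    | inj₂ (_ , rx) = old ¬M rx

      mid-¬touch : ∀ {i x} → M i x → x ∉ Z → ¬ Touches' x
      mid-¬touch m x∉Z = near-¬touch near (near-¬C' near)
        where near = M⇒near m x∉Z

      -- `src i` was the only vertex in touch with `C` that held this label; so no vertex outside
      -- the members competes with `tgt i` for it.
      src≡ : ∀ {i x} → Touches' x → role x ≡ lab (leaf b (piece i) (slot i)) → M i x
      src≡ {i} τ rx = subst (M i) (injective (proj₁ (src∈ i)) (weaken τ) (role-src i) rx) (M-src i)

      inj' : ∀ {x y ℓ ℓ'} → ℓ ≡ ℓ' → Touches' x → Touches' y → Origin x ℓ → Origin y ℓ' → x ≡ y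
      inj' _ τ τ' (mid i m x∉Z) _ = contradiction τ (mid-¬touch m x∉Z)
      inj' _ τ τ' _ (mid i m y∉Z) = contradiction τ' (mid-¬touch m y∉Z)
      inj' e τ τ' (end i refl) (end i' refl) = cong tgt (src-injective
        (injective (proj₁ (src∈ i)) (proj₁ (src∈ i')) (role-src i) (trans (role-src i') (cong lab (≡-sym e)))))
      inj' refl τ τ' (end i _) (old ¬M ry) = contradiction (src≡ τ' ry) (¬M i)
      inj' refl τ τ' (old ¬M rx) (end i _) = contradiction (src≡ τ rx) (¬M i)
      inj' refl τ τ' (old _ rx) (old _ ry) = injective (weaken τ) (weaken τ') rx ry

      keep : ∀ {b' j' x} → Core b' j' x → Core' b' j' x
      keep {x = x} rx = old⇒lab (untouched (spec x)) rx
        where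
        untouched : ∀ {o} → New x o → o ≡ nothing
        untouched (end i refl) = contradiction rx (Field⇒¬core (proj₁ (M⊆W (M-tgt i))))
        untouched (mid i m _)  = contradiction rx (Field⇒¬core (proj₁ (M⊆W m)))
        untouched (off _ _)    = refl

      rc : ∀ {x b' j'} → Touches' x → Origin x (core b' j') → Walk (Core' b' j') E (ρ b' j') x
      rc τ (mid i m x∉Z) = contradiction τ (mid-¬touch m x∉Z)
      rc τ (old _ rx) = Walk-map keep id (rootCore (weaken τ) rx)

      core-mid : ∀ {i x} → M i x → x ≢ tgt i → Core' b (piece i) x
      core-mid {i} {x} m ne with x∉Z ← (λ x∈Z → ne (M∩Z m x∈Z)) = new⇒lab (near-¬C' (M⇒near m x∉Z)) (is-mid (spec x))
        where
        is-mid : ∀ {o} → New x o → o ≡ just (core b (piece i))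
        is-mid (end i' refl) = contradiction (tgt∈ i') x∉Z
        is-mid (mid i' m' _) = cong (λ i → just (core b (piece i))) (disjoint m' m)
        is-mid (off ¬M _)    = contradiction m (¬M i)

      -- The piece is prolonged from the old leaf along the member up to its first arrival at
      -- `tgt i`; if the two coincide, the old attachment serves.
      rooted : ∀ i → ∃ λ z → Walk (Core' b (piece i)) E (ρ b (piece i)) z × E z (tgt i)
      rooted i with rootLeaf (proj₁ (src∈ i)) (role-src i) | Walk-before F._≟_ (walk i)
      ... | z , w , e | inj₁ s≡t           = z , Walk-map keep id w , subst (E z) s≡t e
      ... | z , w , e | inj₂ (y , w' , e') =
        y , (Walk-snoc (Walk-map keep id w) e (Walk-start v) ++ʷ v) , Adj⇒E e'
        where v = Walk-map (λ (m , ne) → core-mid m ne) Adj⇒E w'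

      rl : ∀ {x b' j' i'} → Touches' x → Origin x (leaf b' j' i') →
        ∃ λ z → Walk (Core' b' j') E (ρ b' j') z × E z x
      rl τ (end i refl) = rooted i
      rl τ (old _ rx) with rootLeaf (weaken τ) rx
      ... | z , w , e = z , Walk-map keep id w , e

      next = advance ρ (λ τ τ' ex ey → inj' refl τ τ' (origin ex) (origin ey))
               (λ τ e → rc τ (origin e)) (λ τ e → rl τ (origin e))

  joined : (σ : State) (let open State σ) {Z : List V₀} {D : V₀ → Set} {a a' : V₀} {b b' : Fin 2} →
    (∀ {x} → D x → Avoid Field Z x) → (∀ {x y} → D x → D y → Walk D E x y) →
    Leaf b a → a ∉ Z → (∃ λ c → D c × E c a) → Leaf b' a' → a' ∉ Z → (∃ λ c → D c × E c a') →
    Walk (Avoid Field Z) (Adj edges) a a'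
  joined σ D⊆ conn La a∉ (c , Dc , e) La' a'∉ (c' , Dc' , e') =
    step (inj₂ (_ , La) , a∉) (E⇒Adj (E-sym e))
      (Walk-snoc (Walk-map D⊆ E⇒Adj (conn Dc Dc')) (E⇒Adj e') (inj₂ (_ , La') , a'∉))

  leaf-outside : (σ : State) (let open State σ) → Full → ∀ b {Z} → length Z < P * t →
    ¬ ¬ ∃ λ x → Leaf b x × x ∉ Z
  leaf-outside σ full b {Z} Z<N none = ℕ.<⇒≱ Z<N (length≥-injection vertex vertex-injective λ p →
    decidable-stable (vertex p ∈? Z) λ ∉Z →
      none (vertex p , (proj₁ (proj₂ (filled p)) , _ , _ , proj₂ (proj₂ (filled p))) , ∉Z))
    where
    open State σ
    open import Data.List.Membership.DecPropositional (F._≟_ {n G}) using (_∈?_)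

    filled : (p : Fin (P * t)) → ∃ λ x → Touches x ×
      role x ≡ lab (leaf b (proj₁ (remQuot {P} t p)) (proj₂ (remQuot {P} t p)))
    filled p = full b _ _

    vertex = proj₁ ∘ filled

    vertex-injective : ∀ {p q} → vertex p ≡ vertex q → p ≡ q
    vertex-injective {p} {q} e with trans (≡-sym (proj₂ (proj₂ (filled p)))) (trans (cong role e) (proj₂ (proj₂ (filled q))))
    ... | e' = trans (≡-sym (F.combine-remQuot {P} t p)) (trans (same (lab-injective e')) (F.combine-remQuot {P} t q))
      where
      same : ∀ {j j' : Fin P} {i i' : Fin t} → leaf b j i ≡ leaf b j' i' → combine j i ≡ combine j' i'
      same refl = refl

  -- The progress is a vertex of `C` in `Z`: each family has `P * t` leaves, more than `Z` has
  -- vertices, and if `Z` missed the connected set `C`, then `C` would join two leaves outside `Z`.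
  advance-to-cut : (σ : State) (let open State σ) → Full → (Z : List V₀) → length Z < P * t → length Z ≤ s →
    Menger.Smallest (Separates edges Field (Leaf zero) (Leaf (suc zero))) Z → ¬ ¬ Shrinks σ
  advance-to-cut σ full Z Z<N Z≤s (sep , small) = do
    a  , La  , a∉  ← leaf-outside σ full zero Z<N
    a' , La' , a'∉ ← leaf-outside σ full (suc zero) Z<N
    meets ← meets-C La a∉ La' a'∉
    κ ← cut σ Z Z≤s
    let open Cut κ
    yes (x , Lx , x∉ , τ) ← em (∃ λ x → Leaf zero x × x ∉ Z × ∃ λ c → C' c × E c x)
      where
      no ¬touch → do
        Λ ← Menger.link-to-cut edges Field (Leaf zero) (Leaf (suc zero)) Z (sep , small)
        push σ zero Z sep Λ κ (λ Lx x∉ τ → ¬touch (_ , Lx , x∉ , τ)) meets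
    Λ ← Menger.link-to-cut edges Field (Leaf (suc zero)) (Leaf zero) Z
          (Menger.Separates-sym sep , λ Z' sep' → small Z' (Menger.Separates-sym sep'))
    push σ (suc zero) Z (Menger.Separates-sym sep) Λ κ
      (λ Ly y∉ τ' → sep Lx Ly (joined σ (λ c → inj₁ (C'⊆C c) , C'∌Z c) connected' Lx x∉ τ Ly y∉ τ')) meets
    where
    open State σ
    meets-C : ∀ {a a'} → Leaf zero a → a ∉ Z → Leaf (suc zero) a' → a' ∉ Z →
      ¬ ¬ (∃ λ z → z ∈ Z × C z)
    meets-C La a∉ La' a'∉ none = sep La La'
      (joined σ (λ c → inj₁ c , λ x∈Z → none (_ , x∈Z , c)) connected La a∉ (proj₁ La) La' a'∉ (proj₁ La'))

  LinkedState : Set₁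
  LinkedState = ∃ λ σ → let open State σ in Linkage edges Field (Leaf zero) (Leaf (suc zero)) (P * t)

  shrink-or-link : 1 ≤ s → P * t ≤ s → (σ : State) → let open State σ in
    ¬ ¬ (Shrinks σ ⊎ Linkage edges Field (Leaf zero) (Leaf (suc zero)) (P * t))
  shrink-or-link 1≤s N≤s σ = do
    no none ← em (∃ λ b → ∃₂ λ j i → ¬ ∃ λ x → Touches x × role x ≡ lab (leaf b j i))
      where
      yes (b , j , i , unfilled) → do
        shrunk ← grow 1≤s σ b j i unfilled
        return (inj₁ shrunk)
    full ← ¬¬-Fin λ b → ¬¬-Fin λ j → ¬¬-Fin λ i → λ unfilled → none (b , j , i , unfilled)
    inj₂ (Z , Z<N , small) ← Menger.linkage-or-cut edges Field (Leaf zero) (Leaf (suc zero)) (P * t)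
      where inj₁ Λ → return (inj₂ Λ)
    shrunk ← advance-to-cut σ full Z Z<N (ℕ.≤-trans (ℕ.<⇒≤ Z<N) N≤s) small
    return (inj₁ shrunk)
    where open State σ

  initial : ¬ ¬ State
  initial = do
    x₀ , big₀ ← bigComponent [] z≤n
    let C₀ = Walk (Avoid U []) E x₀
    C₀? ← ¬¬-Fin λ x → em (C₀ x)
    return (start x₀ big₀ C₀?)
    where
    start : ∀ x₀ → Big (Walk (Avoid U []) E x₀) → (∀ x → Dec (Walk (Avoid U []) E x₀ x)) → State
    start x₀ big₀ C₀? = record
      { role      = role
      ; ρ         = λ _ _ → x₀
      ; inU       = λ {x} ne → proj₁ (Walk-end (alive (C₀? x) ne))
      ; connected = λ u v → Walk-map C₀⇒inside id (Walk-map (unrole u ++ʷ_) id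
                      (Walk-reachable (Walk-reverse E-sym (unrole u) ++ʷ unrole v)))
      ; sealed    = λ (c , Cc , e) Ux d → deadly d (Walk-snoc (unrole Cc) e (Ux , λ ()))
      ; injective = λ _ _ rx _ → contradiction rx unlabelled
      ; rootCore  = λ _ rx → contradiction rx unlabelled
      ; rootLeaf  = λ _ rx → contradiction rx unlabelled
      ; big       = Big-mono C₀⇒inside big₀
      }
      where
      C₀ = Walk (Avoid U []) E x₀

      choose : ∀ {X : Set} → Dec X → Role
      choose (yes _) = inside
      choose (no _)  = dead

      role = λ x → choose (C₀? x)

      alive : ∀ {X : Set} (d : Dec X) → choose d ≢ dead → X
      alive (yes p) _  = p
      alive (no _)  ne = contradiction refl ne

      C₀⇒inside : ∀ {x} → C₀ x → role x ≡ inside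
      C₀⇒inside {x} c with C₀? x
      ... | yes _ = refl
      ... | no ¬c = contradiction c ¬c

      unrole : ∀ {x} → role x ≡ inside → C₀ x
      unrole {x} e with C₀? x
      ... | yes c = c

      deadly : ∀ {x} → role x ≡ dead → ¬ C₀ x
      deadly {x} e with C₀? x
      ... | no ¬c = ¬c

      unlabelled : ∀ {x ℓ} → role x ≢ lab ℓ
      unlabelled {x} e with C₀? x
      unlabelled () | yes _
      unlabelled () | no _

  linkedState : 1 ≤ s → P * t ≤ s → ¬ ¬ LinkedState
  linkedState 1≤s N≤s = do
    σ ← initial
    loop (n G) σ (allFin (n G)) (ℕ.≤-reflexive (L.length-tabulate id)) λ {x} _ → ∈-allFin x
    where
    loop : ∀ l (σ : State) (c : List V₀) → length c ≤ l → (∀ {x} → State.C σ x → x ∈ c) → ¬ ¬ LinkedState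
    loop l σ c c≤l C⊆c = do
      inj₁ (σ' , C'⊆C , z , Cz , ¬C'z) ← shrink-or-link 1≤s N≤s σ
        where inj₂ Λ → return (σ , Λ)
      let c' = filter (λ x → ¬? (x F.≟ z)) c
      continue l σ' c'
        (ℕ.<-≤-trans (L.filter-notAll _ c (Any.map (λ { refl ne → ne refl }) (C⊆c Cz))) c≤l)
        λ {x} C'x → ∈-filter⁺ _ (C⊆c (C'⊆C C'x)) λ { refl → ¬C'z C'x }
      where
      continue : ∀ l (σ' : State) (c' : List V₀) → length c' < l → (∀ {x} → State.C σ' x → x ∈ c') → ¬ ¬ LinkedState
      continue (suc l) σ' c' (s≤s c'≤l) = loop l σ' c' c'≤l

  -- A packing from a linked state

  harvest : ∀ {r q} → 1 ≤ r → 1 ≤ t → q * (t + t) + P * P * r ≤ P * t → LinkedState → ¬ ¬ Pack (K2 r) G U q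
  harvest {r} {q} 1≤r 1≤t enough (σ , Λ) = do
    H ← matching q (allFin (P * t)) (Unique.allFin⁺ _)
      (subst (q * (t + t) + P * P * r ≤_) (≡-sym (L.length-tabulate {n = P * t} id)) enough)
    packing H
    where
    open State σ
    open Linkage Λ renaming (disjoint to M-disjoint)

    p p' : Fin (P * t) → Fin P
    p  i = proj₁ (proj₂ (src∈ i))
    p' i = proj₁ (proj₂ (tgt∈ i))

    slot slot' : Fin (P * t) → Fin t
    slot  i = proj₁ (proj₂ (proj₂ (src∈ i)))
    slot' i = proj₁ (proj₂ (proj₂ (tgt∈ i)))

    role-src : ∀ i {j} → p i ≡ j → role (src i) ≡ lab (leaf zero j (slot i))
    role-src i refl = proj₂ (proj₂ (proj₂ (src∈ i)))

    role-tgt : ∀ i {j} → p' i ≡ j → role (tgt i) ≡ lab (leaf (suc zero) j (slot' i))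
    role-tgt i refl = proj₂ (proj₂ (proj₂ (tgt∈ i)))

    thin : ∀ {ys j} → Unique ys → (∀ {y} → y ∈ ys → p y ≡ j) → length ys ≤ t
    thin u pj = Unique⇒length≤ u slot λ {x} {y} x∈ y∈ e → src-injective
      (injective (proj₁ (src∈ x)) (proj₁ (src∈ y)) (role-src x (pj x∈))
        (trans (role-src y (pj y∈)) (cong (λ i → lab (leaf zero _ i)) (≡-sym e))))

    thin' : ∀ {ys j} → Unique ys → (∀ {y} → y ∈ ys → p' y ≡ j) → length ys ≤ t
    thin' u pj = Unique⇒length≤ u slot' λ {x} {y} x∈ y∈ e → tgt-injective
      (injective (proj₁ (tgt∈ x)) (proj₁ (tgt∈ y)) (role-tgt x (pj x∈))
        (trans (role-tgt y (pj y∈)) (cong (λ i → lab (leaf (suc zero) _ i)) (≡-sym e))))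

    open Matching {r = r} p p' thin thin' 1≤t 1≤r

    packing : HeavyMatching q (allFin (P * t)) → ¬ ¬ Pack (K2 r) G U q
    packing H = Pack-branches (K2 r) G zero β (λ {m} {m'} {h} {h'} → apart m m' h h') (λ {m} {h} → region⇒U m h)
      where
      open HeavyMatching H

      -- The cores of a matched pair are the two vertices of degree `r`, and `r` linkage members are
      -- the others. Members lie in `Field`, hence miss every core.
      Region : Fin q → Fin (2 + r) → V₀ → Set
      Region m zero          = Core zero (J m)
      Region m (suc zero)    = Core (suc zero) (J' m)
      Region m (suc (suc l)) = M (item m l)

      root : Fin q → Fin (2 + r) → V₀
      root m zero          = ρ zero (J m)
      root m (suc zero)    = ρ (suc zero) (J' m)
      root m (suc (suc l)) = src (item m l)

      region⇒U : ∀ m h {x} → Region m h x → U x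
      region⇒U m zero          = lab⇒U
      region⇒U m (suc zero)    = lab⇒U
      region⇒U m (suc (suc l)) = Field⇒U ∘ M⊆W

      M⇒¬core : ∀ {i x b j} → M i x → ¬ Core b j x
      M⇒¬core m = Field⇒¬core (M⊆W m)

      core-J : ∀ {b j j' x} → Core b j x → Core b j' x → j ≡ j'
      core-J rx rx' with refl ← lab-injective (trans (≡-sym rx) rx') = refl

      sides : ∀ {j j' x} → Core zero j x → ¬ Core (suc zero) j' x
      sides rx rx' = contradiction (lab-injective (trans (≡-sym rx) rx')) λ ()

      apart : ∀ m m' h h' {x} → Region m h x → Region m' h' x → m ≡ m'
      apart m m' zero          zero           u v = J-inj (core-J u v)
      apart m m' zero          (suc zero)     u v = contradiction v (sides u)
      apart m m' zero          (suc (suc l'))  u v = contradiction u (M⇒¬core v)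
      apart m m' (suc zero)    zero           u v = contradiction u (sides v)
      apart m m' (suc zero)    (suc zero)     u v = J'-inj (core-J u v)
      apart m m' (suc zero)    (suc (suc l'))  u v = contradiction u (M⇒¬core v)
      apart m m' (suc (suc l)) zero           u v = contradiction v (M⇒¬core u)
      apart m m' (suc (suc l)) (suc zero)     u v = contradiction v (M⇒¬core u)
      apart m m' (suc (suc l)) (suc (suc l')) u v =
        J-inj (trans (≡-sym (item-J m l)) (trans (cong p (M-disjoint u v)) (item-J m' l')))

      disj : ∀ m h h' {x} → Region m h x → Region m h' x → h ≡ h'
      disj m zero          zero           u v = refl
      disj m zero          (suc zero)     u v = contradiction v (sides u)
      disj m zero          (suc (suc l'))  u v = contradiction u (M⇒¬core v)
      disj m (suc zero)    zero           u v = contradiction u (sides v)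
      disj m (suc zero)    (suc zero)     u v = refl
      disj m (suc zero)    (suc (suc l'))  u v = contradiction u (M⇒¬core v)
      disj m (suc (suc l)) zero           u v = contradiction v (M⇒¬core u)
      disj m (suc (suc l)) (suc zero)     u v = contradiction v (M⇒¬core u)
      disj m (suc (suc l)) (suc (suc l')) u v = cong (λ l → suc (suc l)) (item-inj m (M-disjoint u v))

      leaf-src : ∀ m l → ∃ λ z → Walk (Core zero (J m)) E (ρ zero (J m)) z × E z (src (item m l))
      leaf-src m l = rootLeaf (proj₁ (src∈ (item m l))) (role-src (item m l) (item-J m l))

      leaf-tgt : ∀ m l → ∃ λ z → Walk (Core (suc zero) (J' m)) E (ρ (suc zero) (J' m)) z × E z (tgt (item m l))
      leaf-tgt m l = rootLeaf (proj₁ (tgt∈ (item m l))) (role-tgt (item m l) (item-J' m l))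

      Link : Fin q → Fin (2 + r) → Fin (2 + r) → Set
      Link m h h' = ∃₂ λ x y → Walk (Region m h) E (root m h) x × Walk (Region m h') E (root m h') y × E x y

      Link-sym : ∀ {m h h'} → Link m h h' → Link m h' h
      Link-sym (x , y , u , v , e) = y , x , v , u , E-sym e

      left : ∀ m l → Link m zero (suc (suc l))
      left m l = let z , w , e = leaf-src m l in z , src (item m l) , w , here (M-src _) , e

      right : ∀ m l → Link m (suc zero) (suc (suc l))
      right m l = let z , w , e = leaf-tgt m l in
        z , tgt (item m l) , w , Walk-map id Adj⇒E (walk (item m l)) , e

      link : ∀ m h h' → Edge (K2 r) h h' → Link m h h'
      link m zero          (suc (suc l)) _ = left m l
      link m (suc zero)    (suc (suc l)) _ = right m l
      link m (suc (suc l)) zero          _ = Link-sym {h = zero} {suc (suc l)} (left m l)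
      link m (suc (suc l)) (suc zero)    _ = Link-sym {h = suc zero} {suc (suc l)} (right m l)
      link m zero zero ()
      link m zero (suc zero) ()
      link m (suc zero) zero ()
      link m (suc zero) (suc zero) ()
      link m (suc (suc l)) (suc (suc l')) ()

      root∈ : ∀ m h → Region m h (root m h)
      -- That a root lies in its core is known only through the walk to a leaf, so an item of the
      -- pair is needed; `1≤r` supplies it.
      root∈ m zero          = Walk-start (proj₁ (proj₂ (leaf-src m (inject≤ zero 1≤r))))
      root∈ m (suc zero)    = Walk-start (proj₁ (proj₂ (leaf-tgt m (inject≤ zero 1≤r))))
      root∈ m (suc (suc l)) = M-src _

      β : Fin q → Branches (K2 r) G
      β m = record
        { Region   = Region m
        ; disjoint = λ {h} {h'} → disj m h h'
        ; root     = root m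
        ; root∈    = root∈ m
        ; link     = λ {h} {h'} → link m h h'
        }

-- Recursion over components

-- Confines each model to a single component, so that hitting sets of the components can be united.
model-connected : {H G : Graph} → (∀ h h' → Walk (λ _ → ⊤) (Edge H) h h') →
  (S : Subgraph G) → IsModel H G S → ∀ {x y} → x Subset.∈ vs S → y Subset.∈ vs S →
  Walk (Subset._∈ vs S) (Edge G) x y
model-connected {H} {G} H-connected S (φ , onto , conn , _ , linked) x∈ y∈ =
  along (H-connected _ _) x∈ y∈ refl refl
  where
  Joined : Fin (n G) → Fin (n G) → Set
  Joined = Walk (Subset._∈ vs S) (Edge G)

  within : ∀ {x y} → x Subset.∈ vs S → y Subset.∈ vs S → φ x ≡ φ y → Joined x y
  within x∈ y∈ e = Walk-map proj₁ (λ {a} {b} e' → proj₁ (es-sub S a b e')) (conn _ _ x∈ y∈ e)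

  along : ∀ {h h' x y} → Walk (λ _ → ⊤) (Edge H) h h' → x Subset.∈ vs S → y Subset.∈ vs S →
    φ x ≡ h → φ y ≡ h' → Joined x y
  along (here _) x∈ y∈ ex ey = within x∈ y∈ (trans ex (≡-sym ey))
  along (step _ e w) x∈ y∈ ex ey with linked _ _ e
  ... | a , b , ab , ea , eb with es-sub S a b ab
  ... | e' , a∈ , b∈ = Walk-snoc (within x∈ a∈ (trans ex (≡-sym ea))) e' b∈ ++ʷ along w b∈ y∈ eb ey

K2-connected : ∀ {r} → 1 ≤ r → ∀ h h' → Walk (λ _ → ⊤) (Edge (K2 r)) h h'
K2-connected {suc r} _ h h' = Walk-reverse (λ {x} {y} e → trans (Graph.sym (K2 (suc r)) y x) e) (hub h) ++ʷ hub h'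
  where
  hub : ∀ h → Walk (λ _ → ⊤) (Edge (K2 (suc r))) zero h
  hub zero          = here _
  hub (suc zero)    = step {y = suc (suc zero)} _ refl (step _ refl (here _))
  hub (suc (suc l)) = step _ refl (here _)

module ErdosPosa {r : ℕ} (1≤r : 1 ≤ r) (G : Graph) where

  private
    V₀ = Fin (n G)
    H  = K2 r

  E : V₀ → V₀ → Set
  E = Edge G

  Hitting : (V₀ → Set) → List V₀ → Set
  Hitting U X = ∀ S → IsModel H G S → (∀ {x} → x Subset.∈ vs S → U x) → ∃ λ x → x Subset.∈ vs S × x ∈ X

  Hits-within : ℕ → (V₀ → Set) → Set
  Hits-within l U = ∃ λ X → length X ≤ l × Hitting U X

  vertex : ∀ S → IsModel H G S → ∃ λ x → x Subset.∈ vs S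
  vertex S (_ , onto , _) = let x , x∈ , _ = onto zero in x , x∈

  path : ∀ {U x y} S → IsModel H G S → (∀ {x} → x Subset.∈ vs S → U x) →
    x Subset.∈ vs S → y Subset.∈ vs S → Walk U E x y
  path S model S⊆ x∈ y∈ = Walk-map S⊆ id (model-connected {H} (K2-connected 1≤r) S model x∈ y∈)

  maximal : ∀ h {C} → ¬ Pack H G C (suc h) → ¬ ¬ ∃ λ q → q ≤ h × Pack H G C q × ¬ Pack H G C (suc q)
  maximal zero ¬p = return (0 , z≤n , Pack-0 H G , ¬p)
  maximal (suc h) {C} ¬p = do
    no ¬p' ← em (Pack H G C (suc h))
      where yes p → return (suc h , ℕ.≤-refl , p , ¬p)
    q , q≤h , rest ← maximal h ¬p'
    return (q , ℕ.m≤n⇒m≤1+n q≤h , rest)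

  module Components (U : V₀ → Set) (B h : ℕ)
    (hits : ∀ q → q ≤ h → ∀ C → ¬ Pack H G C (suc q) → ¬ ¬ Hits-within (B * (q * q)) C)
    where

    Closed : (V₀ → Set) → Set
    Closed W = ∀ {x y} → W x → E x y → U y → W y

    -- `xs` covers `W` and drives the recursion. `q₁` is exactly what the component of `x₀` packs,
    -- so the rest packs at most `q ∸ q₁`, packings of disjoint sets being additive; `q₁ ≤ h` then
    -- makes the bounds add up.
    split-off : ∀ xs {W q} → (∀ {x} → W x → x ∈ xs) → (∀ {x} → W x → U x) → Closed W →
      (∀ x → ¬ Pack H G (Walk U E x) (suc h)) → ¬ Pack H G W (suc q) → ¬ ¬ Hits-within (B * (h * q)) W
    split-off [] W⊆ _ _ _ _ = return ([] , z≤n , λ S model S⊆ →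
      let x , x∈ = vertex S model in contradiction (W⊆ (S⊆ x∈)) λ ())
    split-off (x₀ ∷ xs) {W} {q} W⊆ W⊆U closed small ¬pack = do
      yes Wx₀ ← em (W x₀)
        where no ¬Wx₀ → split-off xs (λ Wx → other (W⊆ Wx) λ { refl → ¬Wx₀ Wx }) W⊆U closed small ¬pack
      let C  = Walk U E x₀
          W' = λ x → W x × ¬ C x
          C⊆W : ∀ {x} → C x → W x
          C⊆W = λ w → proj₂ (Walk-end (Walk-invariant {Q = W} (λ Wx _ e Uy → closed Wx e Uy) Wx₀ w))
      C? ← ¬¬-Fin λ x → em (C x)
      q₁ , q₁≤h , pack₁ , ¬pack₁ ← maximal h (small x₀)
      let q₁≤q : q₁ ≤ q
          q₁≤q = ℕ.≮⇒≥ λ q<q₁ → ¬pack (Pack-≤ H G q<q₁ (Pack-mono H G C⊆W pack₁))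
          ¬pack₂ : ¬ Pack H G W' (suc (q ∸ q₁))
          ¬pack₂ = λ pack₂ → ¬pack (Pack-≤ H G
            (ℕ.≤-reflexive (≡-sym (trans (ℕ.+-suc q₁ (q ∸ q₁)) (cong suc (ℕ.m+[n∸m]≡n q₁≤q)))))
            (Pack-mono H G [ C⊆W , proj₁ ]′ (Pack-∪ H G (λ c (_ , ¬c) → ¬c c) pack₁ pack₂)))
      X₁ , X₁≤ , hit₁ ← hits q₁ q₁≤h C ¬pack₁
      X₂ , X₂≤ , hit₂ ← split-off xs {W'} {q ∸ q₁}
        (λ (Wx , ¬Cx) → other (W⊆ Wx) λ { refl → ¬Cx (here (W⊆U Wx₀)) }) (W⊆U ∘ proj₁)
        (λ (Wx , ¬Cx) e Uy → closed Wx e Uy , λ Cy → ¬Cx (Walk-snoc Cy (E-sym e) (W⊆U Wx))) small ¬pack₂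
      return (X₁ ++ X₂ , bound q₁≤h q₁≤q X₁ X₂ X₁≤ X₂≤ , hit C? hit₁ hit₂)
      where
      E-sym : ∀ {x y} → E x y → E y x
      E-sym {x} {y} e = trans (Graph.sym G y x) e

      other : ∀ {x} → x ∈ x₀ ∷ xs → x ≢ x₀ → x ∈ xs
      other (here e)  ne = contradiction e ne
      other (there p) _  = p

      bound : ∀ {q₁} → q₁ ≤ h → q₁ ≤ q → ∀ X₁ X₂ → length X₁ ≤ B * (q₁ * q₁) → length X₂ ≤ B * (h * (q ∸ q₁)) →
        length (X₁ ++ X₂) ≤ B * (h * q)
      bound {q₁} q₁≤h q₁≤q X₁ X₂ X₁≤ X₂≤ = begin
        length (X₁ ++ X₂)                      ≡⟨ L.length-++ X₁ ⟩
        length X₁ + length X₂                  ≤⟨ ℕ.+-mono-≤ X₁≤ X₂≤ ⟩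
        B * (q₁ * q₁) + B * (h * (q ∸ q₁))     ≤⟨ ℕ.+-monoˡ-≤ _ (ℕ.*-monoʳ-≤ B (ℕ.*-monoˡ-≤ q₁ q₁≤h)) ⟩
        B * (h * q₁) + B * (h * (q ∸ q₁))      ≡⟨ ≡-sym (ℕ.*-distribˡ-+ B _ _) ⟩
        B * (h * q₁ + h * (q ∸ q₁))            ≡⟨ cong (B *_) (≡-sym (ℕ.*-distribˡ-+ h _ _)) ⟩
        B * (h * (q₁ + (q ∸ q₁)))              ≡⟨ cong (λ e → B * (h * e)) (ℕ.m+[n∸m]≡n q₁≤q) ⟩
        B * (h * q)                            ∎
        where open ℕ.≤-Reasoning

      hit : ∀ {X₁ X₂} → (∀ x → Dec (Walk U E x₀ x)) →
        Hitting (Walk U E x₀) X₁ → Hitting (λ x → W x × ¬ Walk U E x₀ x) X₂ → Hitting W (X₁ ++ X₂)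
      hit {X₁} C? hit₁ hit₂ S model S⊆ with vertex S model
      ... | v , v∈ with C? v
      ... | yes Cv = let x , x∈ , x∈X = hit₁ S model (λ x∈ → Cv ++ʷ path S model (W⊆U ∘ S⊆) v∈ x∈)
                     in x , x∈ , ∈-++⁺ˡ x∈X
      ... | no ¬Cv = let x , x∈ , x∈X = hit₂ S model λ x∈ → S⊆ x∈ , λ Cx → ¬Cv (Cx ++ʷ path S model (W⊆U ∘ S⊆) x∈ v∈)
                     in x , x∈ , ∈-++⁺ʳ X₁ x∈X

  -- With P = 8k and t = 16rk, the two terms in `enough` are at most 2k · 32rk and exactly 64k²r,
  -- that is 64rk² each, and P t = 128rk². `cutBound` counts one vertex per label and a cut of P t
  -- vertices.
  pieces slots cutBound : ℕ → ℕ
  pieces k   = 8 * k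
  slots k    = 16 * (r * k)
  cutBound k = 2 * (pieces k * suc (slots k)) + pieces k * slots k

  enough : ∀ k → 1 ≤ k → suc k * (slots k + slots k) + pieces k * pieces k * r ≤ pieces k * slots k
  enough k 1≤k = begin
    suc k * (slots k + slots k) + pieces k * pieces k * r
      ≤⟨ ℕ.+-monoˡ-≤ _ (ℕ.*-monoˡ-≤ (slots k + slots k) (ℕ.+-monoˡ-≤ k 1≤k)) ⟩
    (k + k) * (slots k + slots k) + pieces k * pieces k * r
      ≡⟨ solve 2 (λ r k →
        (k :+ k) :* (con 16 :* (r :* k) :+ con 16 :* (r :* k)) :+ con 8 :* k :* (con 8 :* k) :* r
        := con 8 :* k :* (con 16 :* (r :* k))) refl r k ⟩
    pieces k * slots k ∎
    where open ℕ.≤-Reasoning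
          open import Data.Nat.Solver using (module +-*-Solver)
          open +-*-Solver

  -- Origin of 800: `cutBound k` is 16k + 384rk², at most 400rk², and since 2h ≤ k the components
  -- cost at most half of 800rk².
  total : ∀ k h → h + h ≤ k → cutBound k + 800 * r * (h * k) ≤ 800 * r * (k * k)
  total k h 2h≤k = begin
    2 * (8 * k * suc (slots k)) + 8 * k * slots k + 800 * r * (h * k)
      ≡⟨ solve 3 (λ r k h →
           con 2 :* (con 8 :* k :* (con 1 :+ con 16 :* (r :* k))) :+ con 8 :* k :* (con 16 :* (r :* k))
             :+ con 800 :* r :* (h :* k)
           := con 16 :* (con 1 :* k) :+ con 384 :* (r :* (k :* k)) :+ con 400 :* r :* ((h :+ h) :* k)) refl r k h ⟩
    16 * (1 * k) + 384 * (r * (k * k)) + 400 * r * ((h + h) * k)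
      ≤⟨ ℕ.+-mono-≤ (ℕ.+-monoˡ-≤ (384 * (r * (k * k))) (ℕ.*-monoʳ-≤ 16 (ℕ.*-mono-≤ 1≤r (k≤k*k k))))
           (ℕ.*-monoʳ-≤ (400 * r) (ℕ.*-monoˡ-≤ k 2h≤k)) ⟩
    16 * (r * (k * k)) + 384 * (r * (k * k)) + 400 * r * (k * k)
      ≡⟨ solve 2 (λ r k → con 16 :* (r :* (k :* k)) :+ con 384 :* (r :* (k :* k)) :+ con 400 :* r :* (k :* k)
           := con 800 :* r :* (k :* k)) refl r k ⟩
    800 * r * (k * k) ∎
    where
    open ℕ.≤-Reasoning
    open import Data.Nat.Solver using (module +-*-Solver)
    open +-*-Solver
    k≤k*k : ∀ k → k ≤ k * k
    k≤k*k zero    = z≤n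
    k≤k*k (suc k) = ℕ.m≤m+n (suc k) (k * suc k)

  -- `l` makes the recursion structural: the components are treated with any `q ≤ h`, and `h` is
  -- less than `k`.
  erdosPosa : ∀ l k → k ≤ l → ∀ U → ¬ Pack H G U (suc k) → ¬ ¬ Hits-within (800 * r * (k * k)) U
  erdosPosa l zero _ U ¬pack = return ([] , z≤n , none)
    where
    none : Hitting U []
    none S model S⊆ = contradiction (Pack-1 H G {U} S model S⊆) ¬pack
  erdosPosa (suc l) k@(suc k') (s≤s k'≤l) U ¬pack = do
    yes (X , X≤ , small) ← em (∃ λ X → length X ≤ cutBound k × ∀ x → ¬ Pack H G (Walk (Avoid U X) (Edge G) x) (suc h))
      where
      no none → do
        pack ← contrary none
        contradiction pack ¬pack
    X' , X'≤ , hit ← Components.split-off (Avoid U X) (800 * r) h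
      (λ q q≤h → erdosPosa l q (ℕ.≤-trans q≤h h≤l))
      (allFin _) {Avoid U X} {k} (λ _ → ∈-allFin _) id (λ _ _ p → p) small (¬pack ∘ Pack-mono H G proj₁)
    return (X ++ X' , bound X X' X≤ X'≤ , hits X X' hit)
    where
    h = ⌊ k /2⌋

    2h≤k : h + h ≤ k
    2h≤k = subst (h + h ≤_) (ℕ.⌊n/2⌋+⌈n/2⌉≡n k) (ℕ.+-monoʳ-≤ h (ℕ.⌊n/2⌋≤⌈n/2⌉ k))

    k<2h+2 : suc k ≤ suc h + suc h
    k<2h+2 = begin
      suc k                      ≡⟨ cong suc (≡-sym (ℕ.⌊n/2⌋+⌈n/2⌉≡n k)) ⟩
      suc (h + ⌈ k /2⌉)        ≤⟨ s≤s (ℕ.+-monoʳ-≤ h (ℕ.⌊n/2⌋-mono (ℕ.n≤1+n (suc k)))) ⟩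
      suc (h + suc h)            ∎
      where open ℕ.≤-Reasoning

    h≤l : h ≤ l
    h≤l = ℕ.≤-trans (ℕ.≤-pred (ℕ.⌊n/2⌋<n k')) k'≤l

    Big : (V₀ → Set) → Set
    Big C = Pack H G C (suc h)

    -- Disjoint `C` and `D` would together pack 2h + 2 models, and this is at least k + 1.
    Big-meet : ∀ {C D} → (∀ {x} → C x → U x) → (∀ {x} → D x → U x) → Big C → Big D → ¬ ¬ ∃ λ x → C x × D x
    Big-meet C⊆U D⊆U c d none = ¬pack (Pack-≤ H G k<2h+2 (Pack-mono H G [ C⊆U , D⊆U ]′
      (Pack-∪ H G (λ Cx Dx → none (_ , Cx , Dx)) c d)))

    1≤t : 1 ≤ slots k
    1≤t = ℕ.*-mono-≤ {1} {16} (s≤s z≤n) (ℕ.*-mono-≤ 1≤r (s≤s z≤n))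

    contrary : ¬ (∃ λ X → length X ≤ cutBound k × ∀ x → ¬ Pack H G (Walk (Avoid U X) (Edge G) x) (suc h)) →
      ¬ ¬ Pack H G U (suc k)
    contrary none = do
      Λ ← linkedState (ℕ.*-mono-≤ {1} {pieces k} (s≤s z≤n) 1≤t) ℕ.≤-refl
      harvest 1≤r 1≤t (enough k (s≤s z≤n)) Λ
      where
      open Exploration G U (pieces k) (slots k) (pieces k * slots k) Big (Pack-mono H G) Big-meet
        (λ X X≤ ¬big → none (X , X≤ , λ x p → ¬big (x , p)))

    bound : ∀ X X' → length X ≤ cutBound k → length X' ≤ 800 * r * (h * k) → length (X ++ X') ≤ 800 * r * (k * k)
    bound X X' X≤ X'≤ = ℕ.≤-trans (ℕ.≤-reflexive (L.length-++ X)) (ℕ.≤-trans (ℕ.+-mono-≤ X≤ X'≤) (total k h 2h≤k))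

    hits : ∀ X X' → Hitting (Avoid U X) X' → Hitting U (X ++ X')
    hits X X' hit S model S⊆ with Any.any? (Subset._∈? vs S) X
    ... | yes p = let x , x∈X , x∈S = find p in x , x∈S , ∈-++⁺ˡ x∈X
    ... | no ¬p = let x , x∈S , x∈X' = hit S model (λ x∈ → S⊆ x∈ , λ x∈X → ¬p (lose x∈X x∈)) in x , x∈S , ∈-++⁺ʳ X x∈X'

-- From vertex lists to subsets, and the theorem

listSubset : List (Fin m) → Subset m
listSubset []       = Subset.⊥
listSubset (x ∷ xs) = Subset.⁅ x ⁆ Subset.∪ listSubset xs

∈-listSubset : ∀ {i : Fin m} {xs} → i ∈ xs → i Subset.∈ listSubset xs
∈-listSubset (here refl) = Subset.x∈p∪q⁺ (inj₁ (Subset.x∈⁅x⁆ _))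
∈-listSubset (there p)   = Subset.x∈p∪q⁺ (inj₂ (∈-listSubset p))

∣p∪q∣≤∣p∣+∣q∣ : (p q : Subset m) → ∣ p Subset.∪ q ∣ ≤ ∣ p ∣ + ∣ q ∣
∣p∪q∣≤∣p∣+∣q∣ Vec.[] Vec.[] = z≤n
∣p∪q∣≤∣p∣+∣q∣ (false Vec.∷ p) (false Vec.∷ q) = ∣p∪q∣≤∣p∣+∣q∣ p q
∣p∪q∣≤∣p∣+∣q∣ (false Vec.∷ p) (true  Vec.∷ q) = ℕ.≤-trans (s≤s (∣p∪q∣≤∣p∣+∣q∣ p q))
  (ℕ.≤-reflexive (≡-sym (ℕ.+-suc ∣ p ∣ ∣ q ∣)))
∣p∪q∣≤∣p∣+∣q∣ (true  Vec.∷ p) (false Vec.∷ q) = s≤s (∣p∪q∣≤∣p∣+∣q∣ p q)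
∣p∪q∣≤∣p∣+∣q∣ (true  Vec.∷ p) (true  Vec.∷ q) = s≤s (ℕ.≤-trans (∣p∪q∣≤∣p∣+∣q∣ p q)
  (ℕ.+-monoʳ-≤ ∣ p ∣ (ℕ.n≤1+n _)))

∣listSubset∣≤ : (xs : List (Fin m)) → ∣ listSubset xs ∣ ≤ length xs
∣listSubset∣≤ {m} []   = ℕ.≤-reflexive (Subset.∣⊥∣≡0 m)
∣listSubset∣≤ (x ∷ xs) = ℕ.≤-trans (∣p∪q∣≤∣p∣+∣q∣ Subset.⁅ x ⁆ (listSubset xs))
  (ℕ.+-mono-≤ (ℕ.≤-reflexive (Subset.∣⁅x⁆∣≡1 x)) (∣listSubset∣≤ xs))

∣p∣≥-injection : (p : Subset m) (f : Fin k → Fin m) → (∀ {i j} → f i ≡ f j → i ≡ j) →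
  (∀ i → f i Subset.∈ p) → k ≤ ∣ p ∣
∣p∣≥-injection {k = zero}  p f inj f∈ = z≤n
∣p∣≥-injection {k = suc k} p f inj f∈ = ℕ.≤-trans
  (s≤s (∣p∣≥-injection (p Subset.- f zero) (f ∘ suc) (F.suc-injective ∘ inj)
    λ i → Subset.x∈p∧x≢y⇒x∈p-y (f∈ (suc i)) λ e → contradiction (inj e) λ ()))
  (Subset.x∈p⇒∣p-x∣<∣p∣ (f∈ zero))

pack≤cover : ∀ {H G k m} → IsPackNumber H G k → IsCoverNumber H G m → k ≤ m
pack≤cover {H} {G} ((F , models , disj) , _) ((X , refl , hits) , _) = ∣p∣≥-injection X (proj₁ ∘ hit)
  (λ {i} {j} e → decidable-stable (i F.≟ j) λ i≢j → disj i j i≢j (proj₁ (hit i)) (proj₁ (proj₂ (hit i)))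
    (subst (Subset._∈ vs (F j)) (≡-sym e) (proj₁ (proj₂ (hit j)))))
  (λ i → proj₂ (proj₂ (hit i)))
  where hit = λ i → hits (F i) (models i)

theorem2 : Σ ℕ λ c → ∀ (r : ℕ) → 1 ≤ r → ∀ (G : Graph) (k m : ℕ) →
    IsPackNumber (K2 r) G k → IsCoverNumber (K2 r) G m →
    k ≤ m × m ≤ c * (r * r) * (k * k)
theorem2 = 800 , λ r 1≤r G k m pack cover → pack≤cover {K2 r} {G} pack cover ,
  decidable-stable (m ℕ.≤? 800 * (r * r) * (k * k)) (do
    X , X≤ , hit ← ErdosPosa.erdosPosa 1≤r G k k ℕ.≤-refl (λ _ → ⊤)
      λ (F , π , _) → ℕ.1+n≰n (proj₂ pack (suc k) F π)
    return (bound r 1≤r k X X≤ cover hit))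
  where
  bound : ∀ r → 1 ≤ r → ∀ {G} k {m} X → length X ≤ 800 * r * (k * k) → IsCoverNumber (K2 r) G m →
    (∀ S → IsModel (K2 r) G S → (∀ {x} → x Subset.∈ vs S → ⊤) → ∃ λ x → x Subset.∈ vs S × x ∈ X) →
    m ≤ 800 * (r * r) * (k * k)
  bound r 1≤r k {m} X X≤ cover hit = begin
    m                       ≤⟨ proj₂ cover (listSubset X) (λ S model →
                                 let x , x∈S , x∈X = hit S model _ in x , x∈S , ∈-listSubset x∈X) ⟩
    ∣ listSubset X ∣        ≤⟨ ∣listSubset∣≤ X ⟩
    length X                ≤⟨ X≤ ⟩
    -- The bound obtained is linear in `r`; the quadratic form follows as `r` is positive.
    800 * r * (k * k)       ≤⟨ ℕ.*-monoˡ-≤ (k * k) (ℕ.*-monoʳ-≤ 800 r≤r*r) ⟩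
    800 * (r * r) * (k * k) ∎
    where
    open ℕ.≤-Reasoning
    r≤r*r : r ≤ r * r
    r≤r*r = ℕ.≤-trans (ℕ.≤-reflexive (≡-sym (ℕ.*-identityˡ r))) (ℕ.*-monoˡ-≤ r 1≤r)
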